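{- Let $G$ be the complete graph on $\{0,\dots,n\}$ oriented by $i\to j$ iff $i<j$. For $T\in\mathbb{B}(G)$ and $s\in S_n$, let $c(T,s)$ be the coefficients in the unique expansion $\chi_T=\sum_{s\in S_n}c(T,s)\chi_s$. Then $$c(T,s)=(-1)^{\mathbf{d}(T)+\mathbf{d}(T_s)}\,C(T,T_s).$$ In particular, with $T=\{e_1,\dots,e_n\}$, $\chi_T=\sum_{s\in S_n}(-1)^{\mathbf d(T_s)}\chi_s$.
   Context: $(e_i)_{i=1}^n$ is the standard basis of $\mathbb{R}^n$ and $e_0:=0$; the edge $\{i,j\}$ with $0\le i<j\le n$ is identified with the vector $e_j-e_i$ (its orientation in $G$ is $i\to j$). $\mathbb{B}(G)$ is the set of spanning trees of $G$ with edges oriented as in $G$; $\chi_T$ is the indicator function of $\operatorname{pos}(T)=\{\sum_{x\in T}\lambda_x x:\lambda_x\ge0\}\subset\mathbb{R}^n$. $S_n$ is the set of permutations of $\{1,\dots,n\}$, extended by $s(0):=0$; the path tree $T_s$ is the spanning tree with edges $\{s(k-1),s(k)\}$, $k=1,\dots,n$, oriented as in $G$, and $\chi_s:=\chi_{T_s}$; $\{\chi_s\}$ is a basis of $\operatorname{span}\{\chi_T:T\in\mathbb{B}(G)\}$. Natural orientation: for $T\in\mathbb{B}(G)$, $T_{on}$ is the orientation of the edges of $T$ as a tree rooted at $0$ (every edge directed away from $0$). Distortion: $\mathbf{d}(T)$ is the number of edges of $T$ whose orientation in $G$ differs from their orientation in $T_{on}$. Partial order: $i\prec_T j$ iff $i\ne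 j$ and the path in $T$ from $0$ to $j$ contains $i$. Two trees $T,T'\in\mathbb{B}(G)$ are compatible if there is a total order on $\{0,\dots,n\}$ extending both $\prec_T$ and $\prec_{T'}$; $C(T,T')=1$ if $T,T'$ are compatible and $C(T,T')=0$ otherwise. (Note $\prec_{T_s}$ is the total order $0\prec s(1)\prec\cdots\prec s(n)$.)
   Formalization: The identities between indicator functions hold off finitely many hyperplanes (almost everywhere), not pointwise: for n=2 the pointwise formula fails at the point e_2, where χ_T=1 but the sum is 1-1=0. Uniqueness of the coefficients is proved in the same sense. -}

module Defs where

open import Algebra.Bundles using (CommutativeRing)
import Algebra.Properties.Semiring.Exp as SemiringExp
import Algebra.Properties.Semiring.Sum as SemiringSum
open import Data.Bool.Base using (true; if_then_else_)
open import Data.Empty using (⊥-elim)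
open import Data.Fin.Base using (Fin; zero; suc; inject₁; toℕ; combine; remQuot)
open import Data.Fin.Induction using (<-weakInduction)
open import Data.Fin.Permutation as Perm using (Permutation′; lift₀; insert; _⟨$⟩ʳ_; _⟨$⟩ˡ_)
open import Data.Fin.Properties using (_≟_; _<?_; any?; all?; toℕ-injective; toℕ-inject₁; remQuot-combine)
open import Data.Fin.Subset using (Subset; _∈_)
open import Data.Fin.Subset.Properties using (anySubset?; _∈?_)
open import Data.List.Base using (List; []; _∷_; [_]; allFin; cartesianProduct; concatMap; filter; foldr; length; map)
import Data.List.Membership.DecPropositional as DecMembership
import Data.List.Membership.Propositional as ListMem
open import Data.List.Relation.Unary.All using (All; []; _∷_)
open import Data.List.Relation.Unary.All.Properties using (All¬⇒¬Any; ¬Any⇒All¬)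
open import Data.List.Relation.Unary.AllPairs using ([]; _∷_)
open import Data.List.Relation.Unary.Any using (here; there)
open import Data.List.Relation.Unary.Unique.Propositional using (Unique)
open import Data.Nat.Base using (ℕ; zero; suc; _*_)
import Data.Nat.Base as ℕ
import Data.Nat.Properties as ℕₚ
open import Data.Product.Base using (Σ; ∃; ∃-syntax; _×_; _,_; proj₁; proj₂; uncurry)
open import Data.Sum.Base using (_⊎_; inj₁; inj₂; map₂)
import Data.Vec.Base as Vec
open import Data.Vec.Functional using (Vector)
open import Data.Vec.Properties using (lookup⇒[]=; []=⇒lookup; lookup∘tabulate)
open import Function.Base using (_∘_)
open import Level using (0ℓ; _⊔_) renaming (suc to lsuc)
open import Relation.Binary.Core using (Rel; _⇒_)
open import Relation.Binary.Construct.Closure.ReflexiveTransitive using (Star; ε; _◅_; _◅◅_; reverse)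
open import Relation.Binary.Construct.Closure.Symmetric using (SymClosure; fwd; bwd) renaming (symmetric to symClosure-sym)
open import Relation.Binary.Definitions using (Decidable; Irreflexive; Symmetric; tri<; tri≈; tri>)
open import Relation.Binary.PropositionalEquality using (_≡_; _≢_; refl; sym; trans; cong; subst; subst₂; isEquivalence; resp₂)
open import Relation.Binary.Structures using (IsDecTotalOrder; IsStrictTotalOrder)
open import Relation.Nullary.Decidable using (Dec; yes; no; does; map′; _×-dec_; _⊎-dec_; _→-dec_; ¬?; dec-true)
open import Relation.Nullary.Negation using (¬_; contradiction)
open import Relation.Unary using (Pred)

module _ {V : Set} {A : Rel V 0ℓ} where

  vertices : ∀ {i j} → Star A i j → List V
  vertices {i} ε       = [ i ]
  vertices {i} (_ ◅ p) = i ∷ vertices p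

  IsPath : ∀ {i j} → Star A i j → Set
  IsPath p = Unique (vertices p)

-- A spanning tree of the complete graph on {0,…,n}: a simple graph on this
-- vertex set in which any two vertices are joined by exactly one path.
record SpanningTree (n : ℕ) : Set₁ where
  field
    Adj        : Rel (Fin (suc n)) 0ℓ
    adj?       : Decidable Adj
    adj-sym    : Symmetric Adj
    adj-irrefl : Irreflexive _≡_ Adj
    path       : ∀ i j → Σ (Star Adj i j) IsPath
    path-unique : ∀ {i j} (p q : Star Adj i j) → IsPath p → IsPath q →
                  vertices p ≡ vertices q

  -- Edges carry their orientation in G, that is, (i , j) with i < j.
  edges : List (Fin (suc n) × Fin (suc n))
  edges = filter (λ (i , j) → (i <? j) ×-dec adj? i j)
                 (cartesianProduct (allFin (suc n)) (allFin (suc n)))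

  infix 4 _≺_ _≺?_

  _≺_ : Rel (Fin (suc n)) 0ℓ
  i ≺ j = i ≢ j × i ListMem.∈ vertices (proj₁ (path zero j))

  _≺?_ : Decidable _≺_
  i ≺? j = ¬? (i ≟ j) ×-dec DecMembership._∈?_ _≟_ i (vertices (proj₁ (path zero j)))

  -- i →ₒₙ j: the edge {i,j} is directed from i to j in the natural orientation.
  infix 4 _→ₒₙ_ _→ₒₙ?_

  _→ₒₙ_ : Rel (Fin (suc n)) 0ℓ
  i →ₒₙ j = Adj i j × i ≺ j

  _→ₒₙ?_ : Decidable _→ₒₙ_
  i →ₒₙ? j = adj? i j ×-dec (i ≺? j)

  distortion : ℕ
  distortion = length (filter (λ (i , j) → j →ₒₙ? i) edges)

Compatible : ∀ {n} → SpanningTree n → SpanningTree n → Set₁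
Compatible {n} T T′ = ∃ λ (_<_ : Rel (Fin (suc n)) 0ℓ) → IsStrictTotalOrder _≡_ _<_ ×
  (SpanningTree._≺_ T ⇒ _<_) × (SpanningTree._≺_ T′ ⇒ _<_)

-- Compatibility is decided by searching all relations on the vertex set,
-- coded as subsets of Fin (N * N).
module _ {N : ℕ} where

  record Coded (S : Subset (N * N)) (i j : Fin N) : Set where
    constructor coded
    field uncode : combine i j ∈ S

  encode : {R : Rel (Fin N) 0ℓ} → Decidable R → Subset (N * N)
  encode R? = Vec.tabulate (λ k → does (uncurry R? (remQuot N k)))

  lookup-encode : {R : Rel (Fin N) 0ℓ} (R? : Decidable R) → ∀ i j →
                  Vec.lookup (encode R?) (combine i j) ≡ does (R? i j)
  lookup-encode R? i j =
    trans (lookup∘tabulate _ (combine i j))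
          (cong (does ∘ uncurry R?) (remQuot-combine i j))

  encode⁺ : {R : Rel (Fin N) 0ℓ} (R? : Decidable R) → R ⇒ Coded (encode R?)
  encode⁺ R? {i} {j} r =
    coded (lookup⇒[]= _ _ (trans (lookup-encode R? i j) (dec-true (R? i j) r)))

  encode⁻ : {R : Rel (Fin N) 0ℓ} (R? : Decidable R) → Coded (encode R?) ⇒ R
  encode⁻ {R} R? {i} {j} (coded m) =
    holds (R? i j) (trans (sym (lookup-encode R? i j)) ([]=⇒lookup m))
    where
    holds : (d : Dec (R i j)) → does d ≡ true → R i j
    holds (yes r) _ = r

compatible? : ∀ {n} (T T′ : SpanningTree n) → Dec (Compatible T T′)
compatible? {n} T T′ = map′ fromCode toCode (anySubset? λ S → good? S)
  where
  module T  = SpanningTree T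
  module T′ = SpanningTree T′

  Good : Pred (Subset (suc n * suc n)) 0ℓ
  Good S = (∀ i → ¬ Coded S i i)
         × (∀ i j k → Coded S i j → Coded S j k → Coded S i k)
         × (∀ i j → i ≡ j ⊎ Coded S i j ⊎ Coded S j i)
         × (∀ i j → i T.≺ j → Coded S i j)
         × (∀ i j → i T′.≺ j → Coded S i j)

  good? : ∀ S → Dec (Good S)
  good? S = (all? λ i → ¬? (c? i i))
      ×-dec (all? λ i → all? λ j → all? λ k → c? i j →-dec (c? j k →-dec c? i k))
      ×-dec (all? λ i → all? λ j → (i ≟ j) ⊎-dec (c? i j ⊎-dec c? j i))
      ×-dec (all? λ i → all? λ j → (i T.≺? j) →-dec c? i j)
      ×-dec (all? λ i → all? λ j → (i T′.≺? j) →-dec c? i j)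
    where
    c? : Decidable (Coded S)
    c? i j = map′ coded Coded.uncode (combine i j ∈? S)

  fromCode : ∃ Good → Compatible T T′
  fromCode (S , irr , tr , tot , h , h′) = Coded S , isSTO , h _ _ , h′ _ _
    where
    isSTO : IsStrictTotalOrder _≡_ (Coded S)
    isSTO = record
      { isStrictPartialOrder = record
        { isEquivalence = isEquivalence
        ; irrefl        = λ { refl → irr _ }
        ; trans         = tr _ _ _
        ; <-resp-≈      = resp₂ (Coded S)
        }
      ; compare = cmp
      }
      where
      cmp : ∀ i j → _
      cmp i j with tot i j
      ... | inj₁ refl       = tri≈ (irr i) refl (irr i)
      ... | inj₂ (inj₁ i<j) = tri< i<j (λ { refl → irr _ i<j }) (λ j<i → irr _ (tr _ _ _ i<j j<i))
      ... | inj₂ (inj₂ j<i) = tri> (λ i<j → irr _ (tr _ _ _ i<j j<i)) (λ { refl → irr _ j<i }) j<i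

  toCode : Compatible T T′ → ∃ Good
  toCode (R , isSTO , h , h′) = encode R.<-dec
    , (λ i m → R.irrefl refl (encode⁻ R.<-dec m))
    , (λ i j k m m′ → encode⁺ R.<-dec (R.trans (encode⁻ R.<-dec m) (encode⁻ R.<-dec m′)))
    , (λ i j → total i j)
    , (λ i j → encode⁺ R.<-dec ∘ h)
    , (λ i j → encode⁺ R.<-dec ∘ h′)
    where
    module R where
      open IsStrictTotalOrder isSTO public renaming (_<?_ to <-dec)
    total : ∀ i j → i ≡ j ⊎ Coded (encode R.<-dec) i j ⊎ Coded (encode R.<-dec) j i
    total i j with R.compare i j
    ... | tri< i<j _ _ = inj₂ (inj₁ (encode⁺ R.<-dec i<j))
    ... | tri≈ _ i≡j _ = inj₁ i≡j
    ... | tri> _ _ j<i = inj₂ (inj₂ (encode⁺ R.<-dec j<i))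

module _ {n : ℕ} {A : Rel (Fin n) 0ℓ} where

  open DecMembership (_≟_ {n}) using () renaming (_∈?_ to _∈ₗ?_)

  target∈ : ∀ {i j} (p : Star A i j) → j ListMem.∈ vertices p
  target∈ ε       = here refl
  target∈ (_ ◅ p) = there (target∈ p)

  source∈ : ∀ {i j} (p : Star A i j) → i ListMem.∈ vertices p
  source∈ ε       = here refl
  source∈ (_ ◅ _) = here refl

  suffix : ∀ {i j k} (p : Star A i j) → IsPath p → k ListMem.∈ vertices p → Σ (Star A k j) IsPath
  suffix ε       u       (here refl) = ε , u
  suffix (e ◅ p) u       (here refl) = e ◅ p , u
  suffix (e ◅ p) (_ ∷ u) (there m)   = suffix p u m

  walk⇒path : ∀ {i j} → Star A i j → Σ (Star A i j) IsPath
  walk⇒path ε = ε , ([] ∷ [])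
  walk⇒path {i} (e ◅ p) with walk⇒path p
  ... | q , u with i ∈ₗ? vertices q
  ...   | yes m = suffix q u m
  ...   | no ¬m = e ◅ q , (¬Any⇒All¬ _ ¬m ∷ u)

  -- If adjacent vertices have ranks differing by one and ranks are
  -- distinct, then simple paths are unique.
  module Ranked (rank : Fin n → ℕ) (rank-inj : ∀ {i j} → rank i ≡ rank j → i ≡ j)
                (step : ∀ {i j} → A i j → rank j ≡ suc (rank i) ⊎ rank i ≡ suc (rank j)) where

    stay-above : ∀ {i a b} (p : Star A a b) → ¬ (i ListMem.∈ vertices p) →
                 rank i ℕ.< rank a → rank i ℕ.< rank b
    stay-above ε       _   lt = lt
    stay-above {i} {a} (_◅_ {j = a′} e p) i∉p lt = stay-above p (i∉p ∘ there) lt′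
      where
      lt′ : rank i ℕ.< rank a′
      lt′ with step e
      ... | inj₁ up   = ℕₚ.<-trans lt (subst (rank a ℕ.<_) (sym up) (ℕₚ.n<1+n _))
      ... | inj₂ down = ℕₚ.≤∧≢⇒< (ℕₚ.≤-pred (subst (rank i ℕ.<_) down lt))
                          (λ eq → i∉p (there (subst (ListMem._∈ vertices p) (sym (rank-inj eq)) (source∈ p))))

    stay-below : ∀ {i a b} (p : Star A a b) → ¬ (i ListMem.∈ vertices p) →
                 rank a ℕ.< rank i → rank b ℕ.< rank i
    stay-below ε       _   lt = lt
    stay-below {i} {a} (_◅_ {j = a′} e p) i∉p lt = stay-below p (i∉p ∘ there) lt′
      where
      lt′ : rank a′ ℕ.< rank i
      lt′ with step e
      ... | inj₂ down = ℕₚ.<-trans (subst (rank a′ ℕ.<_) (sym down) (ℕₚ.n<1+n _)) lt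
      ... | inj₁ up   = ℕₚ.≤∧≢⇒< (subst (ℕ._≤ rank i) (sym up) lt)
                          (λ eq → i∉p (there (subst (ListMem._∈ vertices p) (rank-inj eq) (source∈ p))))

    unique : ∀ {i j} (p q : Star A i j) → IsPath p → IsPath q → vertices p ≡ vertices q
    unique ε       ε       _        _        = refl
    unique ε       (_ ◅ q) _        (iq ∷ _) = contradiction (target∈ q) (All¬⇒¬Any iq)
    unique (_ ◅ p) ε       (ip ∷ _) _        = contradiction (target∈ p) (All¬⇒¬Any ip)
    unique {i} (e ◅ p) (e′ ◅ q) (ip ∷ up) (iq ∷ uq) = compare-steps (step e) (step e′)
      where
      above : ∀ {a b} → a ≡ suc b → b ℕ.< a
      above eq = subst (_ ℕ.<_) (sym eq) (ℕₚ.n<1+n _)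
      same : ∀ {a b j} (p : Star A a j) (q : Star A b j) → IsPath p → IsPath q → a ≡ b →
             vertices p ≡ vertices q
      same = λ { p q u u′ refl → unique p q u u′ }
      compare-steps : _ → _ → i ∷ vertices p ≡ i ∷ vertices q
      compare-steps (inj₁ s) (inj₁ s′) = cong (i ∷_) (same p q up uq (rank-inj (trans s (sym s′))))
      compare-steps (inj₂ s) (inj₂ s′) = cong (i ∷_) (same p q up uq (rank-inj (ℕₚ.suc-injective (trans (sym s) s′))))
      compare-steps (inj₁ s) (inj₂ s′) = ⊥-elim (ℕₚ.<-asym
        (stay-above p (All¬⇒¬Any ip) (above s)) (stay-below q (All¬⇒¬Any iq) (above s′)))
      compare-steps (inj₂ s) (inj₁ s′) = ⊥-elim (ℕₚ.<-asym
        (stay-above q (All¬⇒¬Any iq) (above s′)) (stay-below p (All¬⇒¬Any ip) (above s)))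

-- s ∈ S_n is a permutation of Fin n, whose element k stands for the vertex
-- suc k of {0,…,n}; then lift₀ s is the extension of s by s(0) = 0.
module _ {n : ℕ} (s : Permutation′ n) where

  Consecutive : Rel (Fin (suc n)) 0ℓ
  Consecutive i j = ∃[ k ] i ≡ lift₀ s ⟨$⟩ʳ inject₁ k × j ≡ lift₀ s ⟨$⟩ʳ suc k

  consecutive? : Decidable Consecutive
  consecutive? i j = any? λ k → (i ≟ _) ×-dec (j ≟ _)

  rank : Fin (suc n) → ℕ
  rank i = toℕ (lift₀ s ⟨$⟩ˡ i)

  rank-injective : ∀ {i j} → rank i ≡ rank j → i ≡ j
  rank-injective eq = trans (sym (Perm.inverseʳ (lift₀ s)))
    (trans (cong (lift₀ s ⟨$⟩ʳ_) (toℕ-injective eq)) (Perm.inverseʳ (lift₀ s)))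

  consecutive-rank : ∀ {i j} → Consecutive i j → rank j ≡ suc (rank i)
  consecutive-rank (k , refl , refl) =
    trans (cong toℕ (Perm.inverseˡ (lift₀ s) {suc k}))
      (cong suc (sym (trans (cong toℕ (Perm.inverseˡ (lift₀ s) {inject₁ k})) (toℕ-inject₁ k))))

  path-step : ∀ {i j} → SymClosure Consecutive i j → rank j ≡ suc (rank i) ⊎ rank i ≡ suc (rank j)
  path-step (fwd c) = inj₁ (consecutive-rank c)
  path-step (bwd c) = inj₂ (consecutive-rank c)

  from-root : ∀ i → Star (SymClosure Consecutive) zero i
  from-root i = subst (Star _ zero) (Perm.inverseʳ (lift₀ s))
    (<-weakInduction (λ k → Star (SymClosure Consecutive) zero (lift₀ s ⟨$⟩ʳ k)) ε
      (λ k w → w ◅◅ (fwd (k , refl , refl) ◅ ε)) (lift₀ s ⟨$⟩ˡ i))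

  pathTree : SpanningTree n
  pathTree = record
    { Adj         = SymClosure Consecutive
    ; adj?        = λ i j → map′ (λ { (inj₁ c) → fwd c ; (inj₂ c) → bwd c })
                                 (λ { (fwd c) → inj₁ c ; (bwd c) → inj₂ c })
                                 (consecutive? i j ⊎-dec consecutive? j i)
    ; adj-sym     = symClosure-sym _
    ; adj-irrefl  = λ { refl a → irr (path-step a) }
    ; path        = λ i j → walk⇒path (reverse (symClosure-sym _) (from-root i) ◅◅ from-root j)
    ; path-unique = Ranked.unique rank rank-injective path-step
    }
    where
    irr : ∀ {a} → ¬ (a ≡ suc a ⊎ a ≡ suc a)
    irr (inj₁ eq) = ℕₚ.1+n≢n (sym eq)
    irr (inj₂ eq) = ℕₚ.1+n≢n (sym eq)

data FromRoot {n : ℕ} : Rel (Fin (suc n)) 0ℓ where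
  0— : ∀ i → FromRoot zero (suc i)

-- The tree with edges {0,1},…,{0,n}, that is, {e₁,…,eₙ}.
starTree : ∀ n → SpanningTree n
starTree n = record
  { Adj         = SymClosure FromRoot
  ; adj?        = adj?
  ; adj-sym     = symClosure-sym _
  ; adj-irrefl  = λ { refl (fwd ()) ; refl (bwd ()) }
  ; path        = λ i j → walk⇒path (reverse (symClosure-sym _) (walk i) ◅◅ walk j)
  ; path-unique = unique
  }
  where
  adj? : Decidable (SymClosure FromRoot)
  adj? zero    zero    = no λ { (fwd ()) ; (bwd ()) }
  adj? zero    (suc j) = yes (fwd (0— j))
  adj? (suc i) zero    = yes (bwd (0— i))
  adj? (suc i) (suc j) = no λ { (fwd ()) ; (bwd ()) }

  walk : ∀ i → Star (SymClosure (FromRoot {n})) zero i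
  walk zero    = ε
  walk (suc i) = fwd (0— i) ◅ ε

  -- A path leaving 0 cannot return to 0, so it has at most one edge.
  unique₀ : ∀ {j} (p q : Star (SymClosure (FromRoot {n})) zero j) →
            IsPath p → IsPath q → vertices p ≡ vertices q
  unique₀ ε ε _ _ = refl
  unique₀ ε (_ ◅ q) _ (a ∷ _) = contradiction (target∈ q) (All¬⇒¬Any a)
  unique₀ (_ ◅ p) ε (a ∷ _) _ = contradiction (target∈ p) (All¬⇒¬Any a)
  unique₀ (fwd (0— _) ◅ ε) (fwd (0— _) ◅ ε) _ _ = refl
  unique₀ (fwd (0— _) ◅ (bwd (0— _) ◅ p)) _ (a ∷ _) _ =
    contradiction (there (source∈ p)) (All¬⇒¬Any a)
  unique₀ (fwd (0— _) ◅ ε) (fwd (0— _) ◅ (bwd (0— _) ◅ q)) _ (a ∷ _) =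
    contradiction (there (source∈ q)) (All¬⇒¬Any a)

  unique : ∀ {i j} (p q : Star (SymClosure (FromRoot {n})) i j) →
           IsPath p → IsPath q → vertices p ≡ vertices q
  unique {zero} p q u u′ = unique₀ p q u u′
  unique {suc _} ε ε _ _ = refl
  unique {suc _} ε (_ ◅ q) _ (a ∷ _) = contradiction (target∈ q) (All¬⇒¬Any a)
  unique {suc _} (_ ◅ p) ε (a ∷ _) _ = contradiction (target∈ p) (All¬⇒¬Any a)
  unique {suc i} (bwd (0— _) ◅ p) (bwd (0— _) ◅ q) (_ ∷ u) (_ ∷ u′) =
    cong (suc i ∷_) (unique₀ p q u u′)

-- Every permutation of Fin n, up to Perm._≈_, exactly once: choose the image
-- of zero, then a bijection between the remaining elements.
permutations : ∀ n → List (Permutation′ n)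
permutations zero    = [ Perm.id ]
permutations (suc n) = concatMap (λ j → map (insert zero j) (permutations n)) (allFin (suc n))

-- A totally ordered field with decidable order.  Classically, ℝ is one.
record OrderedField c ℓ₁ ℓ₂ : Set (lsuc (c ⊔ ℓ₁ ⊔ ℓ₂)) where
  infix 4 _≤_
  field
    commutativeRing : CommutativeRing c ℓ₁

  open CommutativeRing commutativeRing public
    renaming (refl to ≈-refl; sym to ≈-sym; trans to ≈-trans; zero to *-zero; _*_ to _·_)

  field
    1≉0             : ¬ 1# ≈ 0#
    inverse         : ∀ x → ¬ x ≈ 0# → ∃[ y ] x · y ≈ 1#
    _≤_             : Rel Carrier ℓ₂
    isDecTotalOrder : IsDecTotalOrder _≈_ _≤_
    +-monoˡ-≤       : ∀ z {x y} → x ≤ y → x + z ≤ y + z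
    ·-nonNegative   : ∀ {x y} → 0# ≤ x → 0# ≤ y → 0# ≤ x · y

module Cones {c ℓ₁ ℓ₂} (K : OrderedField c ℓ₁ ℓ₂) where

  open OrderedField K
  open SemiringSum semiring using (sum)
  open SemiringExp semiring using (_^_)

  ∑ : ∀ {a} {A : Set a} → List A → (A → Carrier) → Carrier
  ∑ xs f = foldr (λ x acc → f x + acc) 0# xs

  sign : ℕ → Carrier
  sign m = (- 1#) ^ m

  module _ {n : ℕ} where

    -- e zero is the zero vector and e (suc k) is the (k+1)-st basis vector.
    e : Fin (suc n) → Vector Carrier n
    e zero    _ = 0#
    e (suc j) k = if does (j ≟ k) then 1# else 0#

    edgeVector : Fin (suc n) × Fin (suc n) → Vector Carrier n
    edgeVector (i , j) k = e j k - e i k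

    pos : SpanningTree n → Pred (Vector Carrier n) (c ⊔ ℓ₁ ⊔ ℓ₂)
    pos T v = ∃ λ (w : Fin (suc n) × Fin (suc n) → Carrier) →
      (∀ {x} → x ListMem.∈ SpanningTree.edges T → 0# ≤ w x) ×
      (∀ k → v k ≈ ∑ (SpanningTree.edges T) (λ x → w x · edgeVector x k))

    IsIndicator : ∀ {ℓ} → Pred (Vector Carrier n) ℓ → (Vector Carrier n → Carrier) → Set (c ⊔ ℓ₁ ⊔ ℓ)
    IsIndicator P χ = ∀ v → (P v → χ v ≈ 1#) × (¬ P v → χ v ≈ 0#)

    -- Equality of functions almost everywhere, in the form appropriate to
    -- combinations of indicators of polyhedral cones: equality off finitely
    -- many hyperplanes a⊥, a ≠ 0.  Indicators of closed cones are identified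
    -- up to their boundaries: for n = 2 the three functions χ_T are linearly
    -- independent pointwise, while there are only two functions χ_s.
    infix 4 _≐_
    _≐_ : Rel (Vector Carrier n → Carrier) (c ⊔ ℓ₁)
    f ≐ g = ∃ λ (as : List (Vector Carrier n)) → All (λ a → ¬ (∀ k → a k ≈ 0#)) as ×
      (∀ v → All (λ a → ¬ sum (λ k → a k · v k) ≈ 0#) as → f v ≈ g v)

    C : SpanningTree n → SpanningTree n → Carrier
    C T T′ = if does (compatible? T T′) then 1# else 0#

    -- χ_T = ∑_{s ∈ S_n} a(s) χ_s.
    IsExpansion : (SpanningTree n → Vector Carrier n → Carrier) →
                  SpanningTree n → (Permutation′ n → Carrier) → Set (c ⊔ ℓ₁)
    IsExpansion χ T a = χ T ≐ λ v → ∑ (permutations n) (λ s → a s · χ (pathTree s) v)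

-- For a vertex j ≠ 0 of T let f_j be the sum of v over the vertices whose path
-- from 0 contains j.  Then v = Σ_j f_j (e_j − e_parent(j)) is the only expansion
-- of v in the edges of T, so if no f_j vanishes then (−1)^d(T) χ_T(v) is the product
-- over j of [f_j > 0] − [j < parent(j)].
--
-- Expansion: if p has children a, b in T, this product is the sum of the products
-- for the two trees in which one of a, b is moved below the other.  Iterating over
-- all children of the root at once writes it as a sum over the first letter s(1) of
-- a linear extension s, and recursively as a sum over all linear extensions.
--
-- Uniqueness: suppose Σ_s b(s) χ_s vanishes off finitely many hyperplanes.  Let the
-- coordinate of v at j dominate all others, with the sign of the step from 0 to j.
-- A path starting with i on the wrong side of 0 contributes nothing, and neither
-- does one with i beyond j, since it keeps moving away until it has passed j.  By
-- induction on the distance of j from 0 only the paths starting with j remain, and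
-- the argument continues with j in place of 0 and with the remaining coordinates.
module Submission where

import Algebra.Properties.AbelianGroup as AbelianGroupₚ
import Algebra.Properties.CommutativeMonoid.Sum as CommutativeMonoidSum
import Algebra.Properties.Group as Groupₚ
import Algebra.Properties.Ring as Ringₚ
import Algebra.Properties.Semiring.Exp as SemiringExp
import Algebra.Properties.Semiring.Sum as SemiringSum
import Algebra.Solver.Ring.NaturalCoefficients.Default as NaturalCoefficients
open import Data.Bool.Base using (Bool; true; false; if_then_else_)
import Data.Bool.Properties as Boolₚ
open import Data.Fin.Base as Fin using (Fin; zero; suc; inject₁; punchIn; punchOut; toℕ)
open import Data.Fin.Induction using (<-weakInduction)
open import Data.Fin.Permutation as Perm using (Permutation′; insert; insert-remove; lift₀; remove; _⟨$⟩ʳ_; _⟨$⟩ˡ_)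
open import Data.Fin.Properties as Finₚ using (_≟_; _<?_; any?; all?; ¬∀⟶∃¬; punchIn-injective; punchInᵢ≢i; punchIn-punchOut; toℕ-injective; toℕ-inject₁)
open import Data.List.Base using (List; []; _∷_; [_]; _++_; _∷ʳ_; allFin; cartesianProduct; concatMap; filter; length; map; tabulate)
import Data.List.Membership.DecPropositional as DecMembership
open import Data.List.Membership.Propositional using (_∈_; _∉_)
open import Data.List.Membership.Propositional.Properties using (∈-++⁻; ∈-++⁺ˡ; ∈-++⁺ʳ; ∈-map⁺; ∈-map⁻; ∈-allFin; ∈-filter⁺; ∈-filter⁻; ∈-cartesianProduct⁺)
open import Data.List.Membership.Propositional.Properties.WithK using (unique∧set⇒bag)
open import Data.List.Properties using (length-++; map-tabulate; ∷ʳ-injective; ∷ʳ-injectiveˡ)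
open import Data.List.Relation.Binary.BagAndSetEquality using (∼bag⇒↭)
open import Data.List.Relation.Binary.Permutation.Propositional as ↭ using (_↭_)
open import Data.List.Relation.Binary.Permutation.Propositional.Properties using (filter-↭; ↭-length)
open import Data.List.Relation.Unary.All as All using (All; []; _∷_)
import Data.List.Relation.Unary.All.Properties as Allₚ
open import Data.List.Relation.Unary.AllPairs using ([]; _∷_)
open import Data.List.Relation.Unary.Any using (here; there)
open import Data.List.Relation.Unary.Unique.Propositional using (Unique)
import Data.List.Relation.Unary.Unique.Propositional.Properties as Uniqueₚ
open import Data.Nat.Base as ℕ using (ℕ; zero; suc; z≤n; s≤s; ∣_-_∣) renaming (_+_ to _+ℕ_)
import Data.Nat.Properties as ℕₚ
open import Data.Product.Base using (∃; _×_; _,_; proj₁; proj₂)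
import Data.Product.Properties as Productₚ
open import Data.Sum.Base using (_⊎_; inj₁; inj₂)
open import Data.Vec.Functional using (Vector; insertAt)
open import Data.Vec.Functional.Properties using (insertAt-lookup; insertAt-punchIn)
open import Function.Base using (_∘_; id)
open import Function.Bundles using (mk⇔)
open import Level using (Level; 0ℓ; _⊔_)
open import Relation.Binary.Construct.Closure.ReflexiveTransitive using (Star; ε; _◅_; _◅◅_)
open import Relation.Binary.Construct.Closure.Symmetric using (SymClosure; fwd; bwd)
open import Relation.Binary.Core using (Rel; _⇒_; _Preserves_⟶_)
open import Relation.Binary.Definitions using (Trichotomous; tri<; tri≈; tri>)
open import Relation.Binary.PropositionalEquality as ≡ using (_≡_; _≢_; _≗_; refl; sym; trans; cong; cong₂; subst; isEquivalence; resp₂)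
import Relation.Binary.Reasoning.Setoid as SetoidReasoning
open import Relation.Binary.Structures using (IsDecTotalOrder; IsStrictTotalOrder)
open import Relation.Nullary.Decidable using (Dec; yes; no; does; dec-true; dec-false; does-⇔; _×-dec_; ¬?)
open import Relation.Nullary.Negation using (¬_; contradiction)
open import Relation.Unary using (Decidable; Pred)
open import Defs

-- Write P_T for the product over j. The sign of the theorem arises by passing from χ_T = (-1)^d(T)
-- P_T to P_T as the sum of P_s over linear extensions s, with all coefficients 1, and back through
-- P_s = (-1)^d(T_s) χ_s. The sibling identity is algebraic in step functions: expanding it leaves a
-- constant -1, which is absorbed because exactly one of the two possible edges between a and b is
-- distorted. It holds at every point, so the hyperplanes f_j = 0 enter only where χ is compared
-- with a product. The recursion closes up because the flow entering the set of letters still to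
-- come is the sum of v over that set, whatever the tree. In the uniqueness part the exceptional
-- hyperplanes of a second expansion are arbitrary, so test points must be found off any finite list
-- of them. Coordinates are inserted one at a time, the dominating one last, beyond finitely many
-- forbidden values; only the field operations and the order are used.

-- Simple paths: appending, splitting off the last edge, cutting.

module _ {V : Set} {A : Rel V 0ℓ} where

  vertices-∷ʳ : ∀ {i j k} (p : Star A i j) (e : A j k) → vertices (p ◅◅ (e ◅ ε)) ≡ vertices p ∷ʳ k
  vertices-∷ʳ ε       e = refl
  vertices-∷ʳ (_ ◅ p) e = cong (_ ∷_) (vertices-∷ʳ p e)

  isPath-∷ʳ : ∀ {i j k} (p : Star A i j) (e : A j k) → IsPath p → k ∉ vertices p → IsPath (p ◅◅ (e ◅ ε))
  isPath-∷ʳ p e u k∉p = subst Unique (sym (vertices-∷ʳ p e))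
    (Uniqueₚ.++⁺ u ([] ∷ []) λ { (m , here refl) → k∉p m })

  vertices-last : ∀ {i j} (p : Star A i j) → ∃ λ xs → vertices p ≡ xs ∷ʳ j
  vertices-last ε       = [] , refl
  vertices-last (_ ◅ p) = let xs , eq = vertices-last p in _ ∷ xs , cong (_ ∷_) eq

  -- `Star` exposes the first edge of a path, whereas a parent is found at the far end of the path
  -- from the root; hence a view with the last edge split off.
  record Initial {i j : V} (p : Star A i j) : Set where
    field
      {penultimate} : V
      initial       : Star A i penultimate
      lastEdge      : A penultimate j
      isPath        : IsPath initial
      target∉       : j ∉ vertices initial
      vertices-≡    : vertices p ≡ vertices initial ∷ʳ j

  split-last : ∀ {i k j} (e : A i k) (p : Star A k j) → IsPath (e ◅ p) → Initial (e ◅ p)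
  split-last e ε ((i≢k ∷ []) ∷ _) = record
    { initial = ε ; lastEdge = e ; isPath = [] ∷ []
    ; target∉ = λ { (here refl) → i≢k refl } ; vertices-≡ = refl }
  split-last {i} {j = j} e (e′ ◅ p) (i∉ ∷ u) = record
    { initial    = e ◅ initial
    ; lastEdge   = lastEdge
    ; isPath     = Allₚ.¬Any⇒All¬ _ (i∉p ∘ subst (i ∈_) (sym vertices-≡) ∘ ∈-++⁺ˡ) ∷ isPath
    ; target∉    = λ { (here refl) → i∉p (subst (i ∈_) (sym vertices-≡) (∈-++⁺ʳ _ (here refl)))
                     ; (there m) → target∉ m }
    ; vertices-≡ = cong (i ∷_) vertices-≡
    }
    where
    open Initial (split-last e′ p u)
    i∉p : i ∉ vertices (e′ ◅ p)
    i∉p = Allₚ.All¬⇒¬Any i∉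

  -- A path cut before its end misses `j`, so that `j` can be reattached by another edge, as in
  -- `adj⇒parent`.
  prefix : ∀ {i j v} (p : Star A i j) → IsPath p → v ∈ vertices p → v ≢ j →
           ∃ λ (q : Star A i v) → IsPath q × j ∉ vertices q × (∀ {x} → x ∈ vertices q → x ∈ vertices p)
  prefix ε u (here refl) v≢j = contradiction refl v≢j
  prefix (e ◅ p) _ (here refl) v≢j =
    ε , [] ∷ [] , (λ { (here refl) → v≢j refl }) , (λ { (here refl) → here refl })
  prefix (e ◅ p) (i∉ ∷ u) (there m) v≢j with prefix p u m v≢j
  ... | q , uq , j∉q , q⊆p =
    e ◅ q , Allₚ.¬Any⇒All¬ _ (Allₚ.All¬⇒¬Any i∉ ∘ q⊆p) ∷ uq ,
    (λ { (here refl) → Allₚ.All¬⇒¬Any i∉ (last∈ p) ; (there m′) → j∉q m′ }) ,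
    (λ { (here refl) → here refl ; (there m′) → there (q⊆p m′) })
    where
    last∈ : ∀ {i j} (p : Star A i j) → j ∈ vertices p
    last∈ ε       = here refl
    last∈ (_ ◅ p) = there (last∈ p)

-- A spanning tree rooted at 0: ancestors, parents, edges.

module Rooted {n : ℕ} (T : SpanningTree n) where

  open SpanningTree T
  open DecMembership (_≟_ {suc n}) using (_∈?_)

  ancestors : Fin (suc n) → List (Fin (suc n))
  ancestors j = vertices (proj₁ (path zero j))

  ancestors-unique : ∀ {j} (p : Star Adj zero j) → IsPath p → vertices p ≡ ancestors j
  ancestors-unique {j} p u = path-unique p _ u (proj₂ (path zero j))

  ancestors-zero : ancestors zero ≡ [ zero ]
  ancestors-zero = sym (ancestors-unique ε ([] ∷ []))

  self∈ancestors : ∀ j → j ∈ ancestors j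
  self∈ancestors j = target∈ (proj₁ (path zero j))

  ancestors-injective : ∀ {i j} → ancestors i ≡ ancestors j → i ≡ j
  ancestors-injective {i} {j} eq =
    let xs , p = vertices-last (proj₁ (path zero i))
        ys , q = vertices-last (proj₁ (path zero j))
    in proj₂ (∷ʳ-injective xs ys (trans (sym p) (trans eq q)))

  ancestors-child : ∀ {i j} → Adj i j → j ∉ ancestors i → ancestors j ≡ ancestors i ∷ʳ j
  ancestors-child {i} e j∉ =
    trans (sym (ancestors-unique _ (isPath-∷ʳ p e (proj₂ (path zero i)) j∉))) (vertices-∷ʳ p e)
    where p = proj₁ (path zero i)

  parentOf : ∀ i → ∃ λ x → Adj x (suc i) × suc i ∉ ancestors x × ancestors (suc i) ≡ ancestors x ∷ʳ suc i
  parentOf i with path zero (suc i)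
  ... | e ◅ p , u = penultimate , lastEdge , subst (suc i ∉_) eq target∉ ,
                    trans vertices-≡ (cong (_∷ʳ suc i) eq)
    where
    open Initial (split-last e p u)
    eq : vertices initial ≡ ancestors penultimate
    eq = ancestors-unique initial isPath

  parent : Fin n → Fin (suc n)
  parent i = proj₁ (parentOf i)

  parent-adj : ∀ i → Adj (parent i) (suc i)
  parent-adj i = proj₁ (proj₂ (parentOf i))

  child∉ancestors : ∀ i → suc i ∉ ancestors (parent i)
  child∉ancestors i = proj₁ (proj₂ (proj₂ (parentOf i)))

  ancestors-suc : ∀ i → ancestors (suc i) ≡ ancestors (parent i) ∷ʳ suc i
  ancestors-suc i = proj₂ (proj₂ (proj₂ (parentOf i)))

  ancestors-∷ʳ⇒parent : ∀ {u v} → ancestors v ≡ ancestors u ∷ʳ v → ∃ λ i → v ≡ suc i × u ≡ parent i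
  ancestors-∷ʳ⇒parent {u} {suc i} eq =
    i , refl , ancestors-injective (∷ʳ-injectiveˡ _ _ (trans (sym eq) (ancestors-suc i)))
  ancestors-∷ʳ⇒parent {u} {zero} eq with ancestors u | self∈ancestors u | trans (sym ancestors-zero) eq
  ... | []        | () | _
  ... | _ ∷ []    | _  | ()
  ... | _ ∷ _ ∷ _ | _  | ()

  -- If `v` is off the path to `u`, the edge prolongs that path. Otherwise the path cut at `v`
  -- misses `u`, and the edge prolongs the cut path. Uniqueness of paths turns either prolongation
  -- into a parent relation.
  adj⇒parent : ∀ {u v} → Adj u v → (∃ λ i → v ≡ suc i × u ≡ parent i) ⊎ (∃ λ i → u ≡ suc i × v ≡ parent i)
  adj⇒parent {u} {v} e with v ∈? ancestors u
  ... | no v∉ = inj₁ (ancestors-∷ʳ⇒parent (ancestors-child e v∉))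
  ... | yes v∈ with prefix (proj₁ (path zero u)) (proj₂ (path zero u)) v∈ (λ { refl → adj-irrefl refl e })
  ...   | q , uq , u∉q , _ = inj₂ (ancestors-∷ʳ⇒parent
          (ancestors-child (adj-sym e) (subst (u ∉_) (ancestors-unique q uq) u∉q)))

  infix 4 _≼_ _≼?_

  _≼_ : Rel (Fin (suc n)) 0ℓ
  i ≼ j = i ∈ ancestors j

  _≼?_ : ∀ i j → Dec (i ≼ j)
  i ≼? j = i ∈? ancestors j

  ≼-suc⁻ : ∀ {k i} → k ≼ suc i → k ≡ suc i ⊎ k ≼ parent i
  ≼-suc⁻ {k} {i} m with ∈-++⁻ (ancestors (parent i)) (subst (k ∈_) (ancestors-suc i) m)
  ... | inj₁ m′          = inj₂ m′
  ... | inj₂ (here refl) = inj₁ refl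

  ≼-suc⁺ : ∀ {k i} → k ≼ parent i → k ≼ suc i
  ≼-suc⁺ {k} {i} m = subst (k ∈_) (sym (ancestors-suc i)) (∈-++⁺ˡ m)

  depth : Fin (suc n) → ℕ
  depth = length ∘ ancestors

  depth-suc : ∀ i → depth (suc i) ≡ suc (depth (parent i))
  depth-suc i = trans (cong length (ancestors-suc i))
    (trans (length-++ (ancestors (parent i))) (ℕₚ.+-comm _ 1))

  -- Labels need not decrease towards the root, so the recursion is on the depth.
  parent-induction : ∀ {p} (P : Fin (suc n) → Set p) → P zero → (∀ i → P (parent i) → P (suc i)) → ∀ j → P j
  parent-induction P P0 step j = go (depth j) j ℕₚ.≤-refl
    where
    go : ∀ d j → depth j ℕ.≤ d → P j
    go d zero    _ = P0
    go zero (suc i) le = contradiction (subst (ℕ._≤ 0) (depth-suc i) le) λ ()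
    go (suc d) (suc i) le =
      step i (go d (parent i) (ℕₚ.≤-pred (subst (ℕ._≤ suc d) (depth-suc i) le)))

  parent≢ : ∀ i → parent i ≢ suc i
  parent≢ i eq = child∉ancestors i (subst (suc i ≼_) (sym eq) (self∈ancestors (suc i)))

  -- Going round the cycle would raise the depth by two. Hence no edge is the parent edge of both
  -- its ends, and edges may be indexed by their child ends.
  parent-asym : ∀ {i j} → parent i ≡ suc j → suc i ≢ parent j
  parent-asym {i} {j} eq eq′ = ℕₚ.m≢1+n+m (depth (parent j)) {1} (begin
    depth (parent j)             ≡⟨ cong depth eq′ ⟨
    depth (suc i)                ≡⟨ depth-suc i ⟩
    suc (depth (parent i))       ≡⟨ cong (suc ∘ depth) eq ⟩
    suc (depth (suc j))          ≡⟨ cong suc (depth-suc j) ⟩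
    suc (suc (depth (parent j))) ∎)
    where open ≡.≡-Reasoning

  orientedEdge : Fin n → Fin (suc n) × Fin (suc n)
  orientedEdge i = if does (suc i <? parent i) then (suc i , parent i) else (parent i , suc i)

  orientedEdge-distorted : ∀ {i} → suc i Fin.< parent i → orientedEdge i ≡ (suc i , parent i)
  orientedEdge-distorted {i} lt = cong (if_then (suc i , parent i) else (parent i , suc i)) (dec-true (suc i <? parent i) lt)

  orientedEdge-natural : ∀ {i} → ¬ suc i Fin.< parent i → orientedEdge i ≡ (parent i , suc i)
  orientedEdge-natural {i} ≮ = cong (if_then (suc i , parent i) else (parent i , suc i)) (dec-false (suc i <? parent i) ≮)

  orientedEdge-injective : ∀ {i j} → orientedEdge i ≡ orientedEdge j → i ≡ j
  orientedEdge-injective {i} {j} eq with does (suc i <? parent i) | does (suc j <? parent j)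
  ... | true  | true  = Finₚ.suc-injective (cong proj₁ eq)
  ... | false | false = Finₚ.suc-injective (cong proj₂ eq)
  ... | true  | false = contradiction (cong proj₁ eq) (parent-asym (cong proj₂ eq))
  ... | false | true  = contradiction (cong proj₂ eq) (parent-asym (cong proj₁ eq))

  isEdge? : ∀ (x : Fin (suc n) × Fin (suc n)) → Dec (proj₁ x Fin.< proj₂ x × Adj (proj₁ x) (proj₂ x))
  isEdge? (i , j) = (i <? j) ×-dec adj? i j

  orientedEdge∈edges : ∀ i → orientedEdge i ∈ edges
  orientedEdge∈edges i with suc i <? parent i
  ... | yes lt = subst (_∈ edges) (sym (orientedEdge-distorted lt))
    (∈-filter⁺ isEdge? (∈-cartesianProduct⁺ (∈-allFin _) (∈-allFin _)) (lt , adj-sym (parent-adj i)))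
  ... | no ≮ = subst (_∈ edges) (sym (orientedEdge-natural ≮))
    (∈-filter⁺ isEdge? (∈-cartesianProduct⁺ (∈-allFin _) (∈-allFin _)) (Finₚ.≤∧≢⇒< (ℕₚ.≮⇒≥ ≮) (parent≢ i) , parent-adj i))

  edges∋⇒orientedEdge : ∀ {x} → x ∈ edges → ∃ λ i → x ≡ orientedEdge i
  edges∋⇒orientedEdge {x} m
    with proj₂ (∈-filter⁻ isEdge? {xs = cartesianProduct (allFin (suc n)) (allFin (suc n))} m)
  ... | lt , a with adj⇒parent a
  ...   | inj₁ (i , refl , refl) = i , sym (orientedEdge-natural (ℕₚ.<⇒≯ lt))
  ...   | inj₂ (i , refl , refl) = i , sym (orientedEdge-distorted lt)

  -- Both lists are free of repetitions and have the same members. Sums over `edges` and the count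
  -- in `distortion` thereby become sums and products over the vertices other than the root.
  edges-↭ : edges ↭ map orientedEdge (allFin n)
  edges-↭ = ∼bag⇒↭ (unique∧set⇒bag
    (Uniqueₚ.filter⁺ isEdge? (Uniqueₚ.cartesianProduct⁺ (Uniqueₚ.allFin⁺ (suc n)) (Uniqueₚ.allFin⁺ (suc n))))
    (Uniqueₚ.map⁺ orientedEdge-injective (Uniqueₚ.allFin⁺ n))
    (mk⇔ (λ m → let i , eq = edges∋⇒orientedEdge m in subst (_∈ _) (sym eq) (∈-map⁺ orientedEdge (∈-allFin i)))
         (λ m → let i , _ , eq = ∈-map⁻ orientedEdge m in subst (_∈ edges) (sym eq) (orientedEdge∈edges i))))

  against-natural : ∀ i → does (proj₂ (orientedEdge i) →ₒₙ? proj₁ (orientedEdge i)) ≡ does (suc i <? parent i)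
  against-natural i with suc i <? parent i
  ... | yes lt = trans (cong (λ x → does (proj₂ x →ₒₙ? proj₁ x)) (orientedEdge-distorted lt))
    (trans (dec-true (parent i →ₒₙ? suc i) (parent-adj i , parent≢ i , ≼-suc⁺ (self∈ancestors (parent i))))
           (sym (dec-true (suc i <? parent i) lt)))
  ... | no ≮ = trans (cong (λ x → does (proj₂ x →ₒₙ? proj₁ x)) (orientedEdge-natural ≮))
    (trans (dec-false (suc i →ₒₙ? parent i) (child∉ancestors i ∘ proj₂ ∘ proj₂))
           (sym (dec-false (suc i <? parent i) ≮)))

-- Finite sums, ordered fields, and the sibling identity.

module OrderedFieldProperties {c ℓ₁ ℓ₂} (K : OrderedField c ℓ₁ ℓ₂) where

  open OrderedField K public
  open Cones K public
  open SemiringSum semiring public using (sum; sum-cong-≋; sum-remove; ∑-distrib-+; ∑-comm; sum-permute; *-distribˡ-sum; *-distribʳ-sum; sum-replicate-zero)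
  open SemiringExp semiring public using (^-homo-*)
  open CommutativeMonoidSum *-commutativeMonoid public using ()
    renaming (sum to ∏; sum-cong-≋ to ∏-cong; ∑-distrib-+ to ∏-distrib-·; sum-permute to ∏-permute)
  open Ringₚ ring public using (-‿distribʳ-*; -1*x≈-x)
  open Groupₚ +-group public using () renaming (⁻¹-involutive to -‿involutive; ε⁻¹≈ε to -0≈0; inverseˡ-unique to +-inverseˡ-unique; x∙y⁻¹≈ε⇒x≈y to x-y≈0⇒x≈y)
  open AbelianGroupₚ +-abelianGroup public using (⁻¹-anti-homo‿-)
  open NaturalCoefficients commutativeSemiring public using (solve; _:=_; _:+_; _:*_; con)
  module ≈-Reasoning = SetoidReasoning setoid
  module ≤ = IsDecTotalOrder isDecTotalOrder
  open ≤ public using (_≤?_) renaming (_≟_ to _≈?_)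

  private
    variable
      a : Level
      A B : Set a

  ∑-cong : {f g : A → Carrier} → (∀ x → f x ≈ g x) → ∀ xs → ∑ xs f ≈ ∑ xs g
  ∑-cong eq []       = ≈-refl
  ∑-cong eq (x ∷ xs) = +-cong (eq x) (∑-cong eq xs)

  ∑-zero : ∀ (xs : List A) → ∑ xs (λ _ → 0#) ≈ 0#
  ∑-zero []       = ≈-refl
  ∑-zero (_ ∷ xs) = ≈-trans (+-identityˡ _) (∑-zero xs)

  ∑-++ : ∀ (f : A → Carrier) xs ys → ∑ (xs ++ ys) f ≈ ∑ xs f + ∑ ys f
  ∑-++ f []       ys = ≈-sym (+-identityˡ _)
  ∑-++ f (x ∷ xs) ys = ≈-trans (+-congˡ (∑-++ f xs ys)) (≈-sym (+-assoc _ _ _))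

  ∑-map : ∀ (f : B → Carrier) (g : A → B) xs → ∑ (map g xs) f ≈ ∑ xs (f ∘ g)
  ∑-map f g []       = ≈-refl
  ∑-map f g (x ∷ xs) = +-congˡ (∑-map f g xs)

  ∑-concatMap : ∀ (f : B → Carrier) (g : A → List B) xs → ∑ (concatMap g xs) f ≈ ∑ xs (λ x → ∑ (g x) f)
  ∑-concatMap f g []       = ≈-refl
  ∑-concatMap f g (x ∷ xs) = ≈-trans (∑-++ f (g x) _) (+-congˡ (∑-concatMap f g xs))

  ∑-distribˡ : ∀ k (f : A → Carrier) xs → k · ∑ xs f ≈ ∑ xs (λ x → k · f x)
  ∑-distribˡ k f []       = zeroʳ k
  ∑-distribˡ k f (x ∷ xs) = ≈-trans (distribˡ k _ _) (+-congˡ (∑-distribˡ k f xs))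

  ∑-+ : ∀ (f g : A → Carrier) xs → ∑ xs (λ x → f x + g x) ≈ ∑ xs f + ∑ xs g
  ∑-+ f g []       = ≈-sym (+-identityˡ 0#)
  ∑-+ f g (x ∷ xs) = ≈-trans (+-congˡ (∑-+ f g xs))
    (solve 4 (λ a b c d → (a :+ b) :+ (c :+ d) := (a :+ c) :+ (b :+ d)) ≈-refl (f x) (g x) (∑ xs f) (∑ xs g))

  ∑-tabulate : ∀ {n} (f : A → Carrier) (g : Fin n → A) → ∑ (tabulate g) f ≈ sum (f ∘ g)
  ∑-tabulate {n = zero}  f g = ≈-refl
  ∑-tabulate {n = suc n} f g = +-congˡ (∑-tabulate f (g ∘ suc))

  ∑-↭ : ∀ (f : A → Carrier) {xs ys} → xs ↭ ys → ∑ xs f ≈ ∑ ys f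
  ∑-↭ f ↭.refl         = ≈-refl
  ∑-↭ f (↭.prep x p)   = +-congˡ (∑-↭ f p)
  ∑-↭ f (↭.swap x y p) = ≈-trans (≈-sym (+-assoc _ _ _))
    (≈-trans (+-cong (+-comm _ _) (∑-↭ f p)) (+-assoc _ _ _))
  ∑-↭ f (↭.trans p q)  = ≈-trans (∑-↭ f p) (∑-↭ f q)

  ∑-permutations : ∀ {n} (f : Permutation′ (suc n) → Carrier) →
    ∑ (permutations (suc n)) f ≈ sum (λ j → ∑ (permutations n) (f ∘ insert zero j))
  ∑-permutations {n} f = ≈-trans (∑-concatMap f (λ j → map (insert zero j) (permutations n)) (allFin (suc n)))
    (≈-trans (∑-cong (λ j → ∑-map f (insert zero j) (permutations n)) (allFin (suc n)))
             (∑-tabulate (λ j → ∑ (permutations n) (f ∘ insert zero j)) (λ j → j)))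

  sum-zero : ∀ {n} {f : Fin n → Carrier} → (∀ i → f i ≈ 0#) → sum f ≈ 0#
  sum-zero {n} eq = ≈-trans (sum-cong-≋ eq) (sum-replicate-zero n)

  infix 4 _<_

  _<_ : Carrier → Carrier → Set ℓ₂
  x < y = ¬ y ≤ x

  <⇒≤ : ∀ {x y} → x < y → x ≤ y
  <⇒≤ {x} {y} x<y with ≤.total x y
  ... | inj₁ x≤y = x≤y
  ... | inj₂ y≤x = contradiction y≤x x<y

  ≤-<-trans : ∀ {x y z} → x ≤ y → y < z → x < z
  ≤-<-trans x≤y y<z z≤x = y<z (≤.trans z≤x x≤y)

  <-≤-trans : ∀ {x y z} → x < y → y ≤ z → x < z
  <-≤-trans x<y y≤z z≤x = x<y (≤.trans y≤z z≤x)

  <-respˡ-≈ : ∀ {x y z} → x ≈ y → x < z → y < z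
  <-respˡ-≈ eq x<z z≤y = x<z (≤.trans z≤y (≤.reflexive (≈-sym eq)))

  <-respʳ-≈ : ∀ {x y z} → x ≈ y → z < x → z < y
  <-respʳ-≈ eq z<x y≤z = z<x (≤.trans (≤.reflexive eq) y≤z)

  +-mono-≤ : ∀ {x y u v} → x ≤ y → u ≤ v → x + u ≤ y + v
  +-mono-≤ {x} {y} {u} {v} x≤y u≤v = ≤.trans (+-monoˡ-≤ u x≤y)
    (≤.trans (≤.reflexive (+-comm y u)) (≤.trans (+-monoˡ-≤ y u≤v) (≤.reflexive (+-comm v y))))

  +-cancelʳ-≤ : ∀ {x y} z → x + z ≤ y + z → x ≤ y
  +-cancelʳ-≤ {x} {y} z le = ≤.trans (≤.reflexive (cancel x)) (≤.trans (+-monoˡ-≤ (- z) le) (≤.reflexive (≈-sym (cancel y))))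
    where
    cancel : ∀ w → w ≈ w + z + - z
    cancel w = ≈-sym (≈-trans (+-assoc w z (- z)) (≈-trans (+-congˡ (-‿inverseʳ z)) (+-identityʳ w)))

  +-mono-<-≤ : ∀ {x y u v} → x < y → u ≤ v → x + u < y + v
  +-mono-<-≤ {x} {y} {u} {v} x<y u≤v le =
    x<y (+-cancelʳ-≤ u (≤.trans (+-mono-≤ ≤.refl u≤v) le))

  neg-mono-≤ : ∀ {x y} → x ≤ y → - y ≤ - x
  neg-mono-≤ {x} {y} x≤y = +-cancelʳ-≤ x (≤.trans (+-mono-≤ ≤.refl x≤y)
    (≤.reflexive (≈-trans (-‿inverseˡ y) (≈-sym (-‿inverseˡ x)))))

  0≤⇒-≤0 : ∀ {x} → 0# ≤ x → - x ≤ 0#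
  0≤⇒-≤0 0≤x = ≤.trans (neg-mono-≤ 0≤x) (≤.reflexive -0≈0)

  ≤0⇒0≤- : ∀ {x} → x ≤ 0# → 0# ≤ - x
  ≤0⇒0≤- x≤0 = ≤.trans (≤.reflexive (≈-sym -0≈0)) (neg-mono-≤ x≤0)

  -1² : - 1# · - 1# ≈ 1#
  -1² = ≈-trans (-1*x≈-x (- 1#)) (-‿involutive 1#)

  0≤1 : 0# ≤ 1#
  0≤1 with ≤.total 0# 1#
  ... | inj₁ 0≤1 = 0≤1
  ... | inj₂ 1≤0 = ≤.trans (·-nonNegative (≤0⇒0≤- 1≤0) (≤0⇒0≤- 1≤0)) (≤.reflexive -1²)

  0<1 : 0# < 1#
  0<1 1≤0 = 1≉0 (≤.antisym 1≤0 0≤1)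

  x<x+1 : ∀ x → x < x + 1#
  x<x+1 x = <-respˡ-≈ (+-identityˡ x) (<-respʳ-≈ (+-comm 1# x) (+-mono-<-≤ 0<1 ≤.refl))

  𝟙 : Bool → Carrier
  𝟙 b = if b then 1# else 0#

  -- The Heaviside function, with value 0 at 0.
  θ : Carrier → Carrier
  θ x = if does (x ≤? 0#) then 0# else 1#

  θ-pos : ∀ {x} → 0# < x → θ x ≈ 1#
  θ-pos {x} 0<x with x ≤? 0#
  ... | yes x≤0 = contradiction x≤0 0<x
  ... | no  _   = ≈-refl

  θ-≤0 : ∀ {x} → x ≤ 0# → θ x ≈ 0#
  θ-≤0 {x} x≤0 with x ≤? 0#
  ... | yes _   = ≈-refl
  ... | no  0<x = contradiction x≤0 0<x

  θ-cong : ∀ {x y} → x ≈ y → θ x ≈ θ y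
  θ-cong {x} {y} eq with y ≤? 0#
  ... | yes y≤0 = θ-≤0 (≤.trans (≤.reflexive eq) y≤0)
  ... | no  0<y = θ-pos (<-respʳ-≈ (≈-sym eq) 0<y)

  δ : ℕ → ℕ → Carrier
  δ q p = if does (q ℕₚ.<? p) then - 1# else 0#

  δ-< : ∀ {q p} → q ℕ.< p → δ q p ≈ - 1#
  δ-< {q} {p} lt = reflexive (cong (if_then - 1# else 0#) (dec-true (q ℕₚ.<? p) lt))

  δ-≮ : ∀ {q p} → ¬ q ℕ.< p → δ q p ≈ 0#
  δ-≮ {q} {p} ≮ = reflexive (cong (if_then - 1# else 0#) (dec-false (q ℕₚ.<? p) ≮))

  -- The right side is θ(x+y) times θ(x) + θ(y) - 1. The second factor vanishes when exactly one of
  -- x, y is positive; when both or neither are, the sign of x + y is known.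
  θ-+ : ∀ x y → θ x · θ y ≈ θ (x + y) · θ x + θ (x + y) · θ y + θ (x + y) · - 1#
  θ-+ x y with x ≤? 0# | y ≤? 0#
  ... | yes x≤0 | yes y≤0 = ≈-trans
    (solve 1 (λ m → con 0 :* con 0 := con 0 :* con 0 :+ con 0 :* con 0 :+ con 0 :* m) ≈-refl (- 1#))
    (≈-sym (+-cong (+-cong (*-congʳ γ) (*-congʳ γ)) (*-congʳ γ)))
    where
    γ : θ (x + y) ≈ 0#
    γ = θ-≤0 (≤.trans (+-mono-≤ x≤0 y≤0) (≤.reflexive (+-identityˡ 0#)))
  ... | no 0<x | no 0<y = begin
    1# · 1#                          ≈⟨ *-identityˡ 1# ⟩
    1#                               ≈⟨ +-identityʳ 1# ⟨
    1# + 0#                          ≈⟨ +-congˡ (-‿inverseʳ 1#) ⟨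
    1# + (1# + - 1#)                 ≈⟨ solve 1 (λ m → con 1 :+ (con 1 :+ m) := con 1 :* con 1 :+ con 1 :* con 1 :+ con 1 :* m) ≈-refl (- 1#) ⟩
    1# · 1# + 1# · 1# + 1# · - 1#    ≈⟨ +-cong (+-cong (*-congʳ γ) (*-congʳ γ)) (*-congʳ γ) ⟨
    θ (x + y) · 1# + θ (x + y) · 1# + θ (x + y) · - 1# ∎
    where
    open ≈-Reasoning
    γ : θ (x + y) ≈ 1#
    γ = θ-pos (<-respˡ-≈ (+-identityˡ 0#) (+-mono-<-≤ 0<x (<⇒≤ 0<y)))
  ... | no _ | yes _ = begin
    1# · 0#                          ≈⟨ zeroʳ 1# ⟩
    0#                               ≈⟨ zeroʳ γ ⟨
    γ · 0#                           ≈⟨ *-congˡ (-‿inverseʳ 1#) ⟨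
    γ · (1# + - 1#)                  ≈⟨ solve 2 (λ g m → g :* (con 1 :+ m) := g :* con 1 :+ g :* con 0 :+ g :* m) ≈-refl γ (- 1#) ⟩
    γ · 1# + γ · 0# + γ · - 1#       ∎
    where
    open ≈-Reasoning
    γ = θ (x + y)
  ... | yes _ | no _ = begin
    0# · 1#                          ≈⟨ zeroˡ 1# ⟩
    0#                               ≈⟨ zeroʳ γ ⟨
    γ · 0#                           ≈⟨ *-congˡ (-‿inverseʳ 1#) ⟨
    γ · (1# + - 1#)                  ≈⟨ solve 2 (λ g m → g :* (con 1 :+ m) := g :* con 0 :+ g :* con 1 :+ g :* m) ≈-refl γ (- 1#) ⟩
    γ · 0# + γ · 1# + γ · - 1#       ∎
    where
    open ≈-Reasoning
    γ = θ (x + y)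

  δ-+ : ∀ {a b} → a ≢ b → δ b a + δ a b ≈ - 1#
  δ-+ {a} {b} a≢b with ℕₚ.<-cmp a b
  ... | tri< lt _ _ = ≈-trans (+-cong (δ-≮ (ℕₚ.<⇒≯ lt)) (δ-< lt)) (+-identityˡ _)
  ... | tri≈ _ eq _ = contradiction eq a≢b
  ... | tri> _ _ gt = ≈-trans (+-cong (δ-< gt) (δ-≮ (ℕₚ.<⇒≯ gt))) (+-identityʳ _)

  -- The larger of a, b decides: if it lies below `p`, so does the smaller. On the right only the
  -- term of the larger one survives, multiplied by -1.
  δ-· : ∀ p {a b} → a ≢ b → δ a p · δ b p ≈ δ a p · δ b a + δ b p · δ a b
  δ-· p {a} {b} a≢b with ℕₚ.<-cmp a b
  ... | tri≈ _ eq _ = contradiction eq a≢b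
  ... | tri< a<b _ _ = ≈-trans eq
        (≈-sym (≈-trans (+-cong (≈-trans (*-congˡ (δ-≮ (ℕₚ.<⇒≯ a<b))) (zeroʳ _)) (*-congˡ (δ-< a<b))) (+-identityˡ _)))
    where
    eq : δ a p · δ b p ≈ δ b p · - 1#
    eq with b ℕₚ.<? p
    ... | yes b<p = ≈-trans (*-comm _ _) (*-congˡ (δ-< (ℕₚ.<-trans a<b b<p)))
    ... | no  b≮p = ≈-trans (*-congˡ (δ-≮ b≮p)) (≈-trans (zeroʳ _) (≈-sym (≈-trans (*-congʳ (δ-≮ b≮p)) (zeroˡ _))))
  ... | tri> _ _ b<a = ≈-trans eq
        (≈-sym (≈-trans (+-cong (*-congˡ (δ-< b<a)) (≈-trans (*-congˡ (δ-≮ (ℕₚ.<⇒≯ b<a))) (zeroʳ _))) (+-identityʳ _)))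
    where
    eq : δ a p · δ b p ≈ δ a p · - 1#
    eq with a ℕₚ.<? p
    ... | yes a<p = *-congˡ (δ-< (ℕₚ.<-trans b<a a<p))
    ... | no  a≮p = ≈-trans (*-congʳ (δ-≮ a≮p)) (≈-trans (zeroˡ _) (≈-sym (≈-trans (*-congʳ (δ-≮ a≮p)) (zeroˡ _))))

  -- For x ≠ 0 and an edge p → q of the natural orientation carrying the flow x,
  -- this is [x > 0] if p < q, and −[x < 0] if the edge is distorted.
  factor : ℕ → ℕ → Carrier → Carrier
  factor p q x = θ x + δ q p

  -- A tree in which p has children a and b is the sum of the two trees in which
  -- one of a, b is moved below the other, which then carries the flow of both.
  factor-siblings : ∀ p {a b} x y → a ≢ b →
    factor p a x · factor p b y ≈ factor p a (x + y) · factor a b y + factor p b (x + y) · factor b a x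
  factor-siblings p {a} {b} x y a≢b = begin
    (α + X) · (β + Y)
      ≈⟨ solve 4 (λ α β X Y → (α :+ X) :* (β :+ Y) := α :* β :+ (α :* Y :+ X :* β) :+ X :* Y) ≈-refl α β X Y ⟩
    α · β + (α · Y + X · β) + X · Y
      -- The -1 of `θ-+` is split as `δ b a + δ a b`; this supplies the products of γ with the
      -- corrections of the two new edges.
      ≈⟨ +-cong (+-congʳ (≈-trans (θ-+ x y) (+-congˡ (*-congˡ (≈-sym (δ-+ a≢b)))))) (δ-· p a≢b) ⟩
    γ · α + γ · β + γ · (Z + Z′) + (α · Y + X · β) + (X · Z + Y · Z′)
      ≈⟨ solve 7 (λ α β γ X Y Z Z′ →
           γ :* α :+ γ :* β :+ γ :* (Z :+ Z′) :+ (α :* Y :+ X :* β) :+ (X :* Z :+ Y :* Z′) :=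
           (γ :+ X) :* (β :+ Z) :+ (γ :+ Y) :* (α :+ Z′)) ≈-refl α β γ X Y Z Z′ ⟩
    (γ + X) · (β + Z) + (γ + Y) · (α + Z′) ∎
    where
    open ≈-Reasoning
    α = θ x
    β = θ y
    γ = θ (x + y)
    X = δ a p
    Y = δ b p
    Z = δ b a
    Z′ = δ a b

-- Choosing the top one among siblings; products along a path.

module PathProducts {c ℓ₁ ℓ₂} (K : OrderedField c ℓ₁ ℓ₂) where

  open OrderedFieldProperties K

  -- Elements with min k ≡ true hang below the vertex q, the others
  -- contribute the fixed factor c k.
  siblingFactor : ∀ {m} (min : Fin m → Bool) (label : Fin m → ℕ) (f c : Fin m → Carrier) → ℕ → Fin m → Carrier
  siblingFactor min label f c q k = if min k then factor q (label k) (f k) else c k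

  total : ∀ {m} (min : Fin m → Bool) (f : Fin m → Carrier) → Carrier
  total min f = sum λ k → if min k then f k else 0#

  -- The weight of the edge from `q` to a minimal element under which all other minimal ones have
  -- been moved, so that it carries the whole flow `t`.
  choice : ∀ {m} (min : Fin m → Bool) (label : Fin m → ℕ) → Carrier → ℕ → Fin m → Carrier
  choice min label t q k = if min k then factor q (label k) t else 0#

  if-congˡ : ∀ b {x y z} → x ≈ y → (if b then x else z) ≈ (if b then y else z)
  if-congˡ true  eq = eq
  if-congˡ false eq = ≈-refl

  if-false : ∀ {b} {x y : Carrier} → b ≢ true → (if b then x else y) ≈ y
  if-false {true}  b≢ = contradiction refl b≢
  if-false {false} _  = ≈-refl

  factor-cong : ∀ p q {x y} → x ≈ y → factor p q x ≈ factor p q y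
  factor-cong p q eq = +-congʳ (θ-cong eq)

  -- Induction on the index set. A non-minimal `zero` is a constant factor. Otherwise the induction
  -- hypothesis selects a top element `j` of the rest, and `factor-siblings` compares it with
  -- `zero`; distinct labels are what that identity requires.
  one-step : ∀ {m} (min : Fin (suc m) → Bool) (label : Fin (suc m) → ℕ) (f c : Fin (suc m) → Carrier) →
    (∀ {j k} → label j ≡ label k → j ≡ k) → (∃ λ k → min k ≡ true) → ∀ q →
    ∏ (siblingFactor min label f c q) ≈
    sum λ j → choice min label (total min f) q j · ∏ (siblingFactor min label f c (label j) ∘ punchIn j)
  one-step {zero} min label f c inj (zero , eq) q rewrite eq =
    ≈-sym (≈-trans (+-identityʳ _) (*-congʳ (factor-cong q (label zero) (+-identityʳ (f zero)))))
  one-step {suc m} min label f c inj (k , eq) q with min zero in eq₀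
  one-step {suc m} min label f c inj (zero , eq) q | false = contradiction (≡.trans (sym eq₀) eq) λ ()
  one-step {suc m} min label f c inj (suc k , eq) q | false = begin
    c zero · ∏ (F q)
      ≈⟨ *-congˡ (one-step (min ∘ suc) (label ∘ suc) (f ∘ suc) (c ∘ suc) (Finₚ.suc-injective ∘ inj) (k , eq) q) ⟩
    c zero · sum (λ j → g j · ∏ (F (label (suc j)) ∘ punchIn j))
      ≈⟨ *-distribˡ-sum (c zero) (λ j → g j · Π j) ⟩
    sum (λ j → c zero · (g j · Π j))
      ≈⟨ sum-cong-≋ (λ j → ≈-trans (solve 3 (λ x y z → x :* (y :* z) := y :* (x :* z)) ≈-refl (c zero) (g j) (Π j))
           (*-congʳ {x = c zero · Π j} (if-congˡ (min (suc j)) (factor-cong q (label (suc j)) (≈-sym (+-identityˡ _)))))) ⟩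
    sum (λ j → h j · (c zero · Π j))
      ≈⟨ +-identityˡ _ ⟨
    0# + sum (λ j → h j · (c zero · Π j))
      ≈⟨ +-congʳ (zeroˡ _) ⟨
    0# · ∏ (F (label zero)) + sum (λ j → h j · (c zero · Π j)) ∎
    where
    open ≈-Reasoning
    F = siblingFactor (min ∘ suc) (label ∘ suc) (f ∘ suc) (c ∘ suc)
    g h Π : Fin (suc m) → Carrier
    Π j = ∏ (F (label (suc j)) ∘ punchIn j)
    g = choice (min ∘ suc) (label ∘ suc) (total (min ∘ suc) (f ∘ suc)) q
    h = choice (min ∘ suc) (label ∘ suc) (0# + total (min ∘ suc) (f ∘ suc)) q
  one-step {suc m} min label f c inj _ q | true with any? (λ k → min (suc k) Boolₚ.≟ true)
  -- Here `zero` alone is minimal: it carries the total flow, no other element can be chosen, and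
  -- the remaining factors are constants.
  ... | no none = begin
    factor q (label zero) (f zero) · ∏ (F q)
      ≈⟨ *-cong (factor-cong q (label zero) (≈-sym (≈-trans (+-congˡ (sum-zero {f = λ k → if min (suc k) then f (suc k) else 0#} (λ k → nonmin k))) (+-identityʳ _))))
           (∏-cong {x = F q} {y = F (label zero)} (λ k → ≈-trans (nonmin k) (≈-sym (nonmin k)))) ⟩
    factor q (label zero) t · ∏ (F (label zero))
      ≈⟨ +-identityʳ _ ⟨
    factor q (label zero) t · ∏ (F (label zero)) + 0#
      ≈⟨ +-congˡ (sum-zero {f = λ j → h j · P j} (λ j → ≈-trans (*-congʳ {x = P j} (nonmin j)) (zeroˡ (P j)))) ⟨
    factor q (label zero) t · ∏ (F (label zero)) + sum (λ j → h j · P j) ∎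
    where
    open ≈-Reasoning
    F = siblingFactor (min ∘ suc) (label ∘ suc) (f ∘ suc) (c ∘ suc)
    t = f zero + total (min ∘ suc) (f ∘ suc)
    nonmin : ∀ k {x y : Carrier} → (if min (suc k) then x else y) ≈ y
    nonmin k = if-false (λ e → none (k , e))
    h P : Fin (suc m) → Carrier
    P j = factor (label (suc j)) (label zero) (f zero) · ∏ (F (label (suc j)) ∘ punchIn j)
    h = choice (min ∘ suc) (label ∘ suc) t q
  ... | yes some = begin
    factor q a x · ∏ (F q)
      ≈⟨ *-congˡ (IH q) ⟩
    factor q a x · sum (λ j → g q j · Π j)
      ≈⟨ *-distribˡ-sum (factor q a x) (λ j → g q j · Π j) ⟩
    sum (λ j → factor q a x · (g q j · Π j))
      -- The first summand hangs `zero` at `q` and `j` below `zero`, the second hangs `j` at `q` and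
      -- `zero` below `j`; the upper one always carries `t`.
      ≈⟨ sum-cong-≋ term ⟩
    sum (λ j → factor q a t · (g a j · Π j) + h j · (factor (b j) a x · Π j))
      ≈⟨ ∑-distrib-+ (λ j → factor q a t · (g a j · Π j)) (λ j → h j · (factor (b j) a x · Π j)) ⟩
    sum (λ j → factor q a t · (g a j · Π j)) + sum (λ j → h j · (factor (b j) a x · Π j))
      -- The induction hypothesis, read backwards and started at `a`, reassembles all terms with
      -- `zero` on top.
      ≈⟨ +-congʳ (≈-trans (*-congˡ (IH a)) (*-distribˡ-sum (factor q a t) (λ j → g a j · Π j))) ⟨
    factor q a t · ∏ (F a) + sum (λ j → h j · (factor (b j) a x · Π j)) ∎
    where
    open ≈-Reasoning
    F = siblingFactor (min ∘ suc) (label ∘ suc) (f ∘ suc) (c ∘ suc)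
    IH = one-step (min ∘ suc) (label ∘ suc) (f ∘ suc) (c ∘ suc) (Finₚ.suc-injective ∘ inj) some
    a = label zero
    b = label ∘ suc
    x = f zero
    y = total (min ∘ suc) (f ∘ suc)
    t = x + y
    g : ℕ → Fin (suc m) → Carrier
    g = choice (min ∘ suc) b y
    h Π : Fin (suc m) → Carrier
    h = choice (min ∘ suc) b t q
    Π j = ∏ (F (b j) ∘ punchIn j)
    a≢b : ∀ j → a ≢ b j
    a≢b j e = Finₚ.0≢1+n (inj e)
    term : ∀ j → factor q a x · (g q j · Π j) ≈ factor q a t · (g a j · Π j) + h j · (factor (b j) a x · Π j)
    term j with min (suc j)
    ... | false = solve 4 (λ u v w P → u :* (con 0 :* P) := v :* (con 0 :* P) :+ con 0 :* (w :* P)) ≈-refl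
                    (factor q a x) (factor q a t) (factor (b j) a x) (Π j)
    ... | true  = ≈-trans (≈-sym (*-assoc _ _ _)) (≈-trans (*-congʳ (factor-siblings q x y (a≢b j)))
                    (solve 5 (λ u v w z P → (u :* v :+ w :* z) :* P := u :* (v :* P) :+ w :* (z :* P)) ≈-refl
                      (factor q a t) (factor a (b j) y) (factor q (b j) t) (factor (b j) a x) (Π j)))

  -- The tree product of a path that starts at `p`: the flow into a vertex of a path is the sum of
  -- `x` over that vertex and all later ones.
  pathProduct : ∀ {m} → ℕ → (Fin m → ℕ) → (Fin m → Carrier) → Carrier
  pathProduct {zero}  p label x = 1#
  pathProduct {suc m} p label x = factor p (label zero) (sum x) · pathProduct (label zero) (label ∘ suc) (x ∘ suc)

  pathProduct-cong : ∀ {m} p {label label′ : Fin m → ℕ} {x x′ : Fin m → Carrier} →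
    label ≗ label′ → (∀ k → x k ≈ x′ k) → pathProduct p label x ≈ pathProduct p label′ x′
  pathProduct-cong {zero}  p eq eq′ = ≈-refl
  pathProduct-cong {suc m} p {label} {label′} eq eq′ rewrite eq zero =
    *-cong (factor-cong p (label′ zero) (sum-cong-≋ eq′)) (pathProduct-cong (label′ zero) (eq ∘ suc) (eq′ ∘ suc))

-- Sums over the linear extensions of a forest.

label : ∀ {n} → Fin n → ℕ
label i = suc (toℕ i)

insert-suc : ∀ {m} (j : Fin (suc m)) (π : Permutation′ m) k → insert zero j π ⟨$⟩ʳ suc k ≡ punchIn j (π ⟨$⟩ʳ k)
insert-suc j π k = Perm.insert-punchIn zero j π k

module Forest {n : ℕ} (parent : Fin n → Fin (suc n)) where

  Minimal : ∀ {m} → (Fin m → Fin n) → Fin n → Set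
  Minimal ι i = ¬ ∃ λ l → parent i ≡ suc (ι l)

  minimal? : ∀ {m} (ι : Fin m → Fin n) i → Dec (Minimal ι i)
  minimal? ι i = ¬? (any? λ l → parent i ≟ suc (ι l))

  -- Up means away from the root. The sets that remain when an initial part of a linear extension is
  -- deleted are of this kind.
  UpClosed : ∀ {m} → (Fin m → Fin n) → Set
  UpClosed ι = ∀ {i k} → parent i ≡ suc (ι k) → ∃ λ l → ι l ≡ i

  Minimal-⊆ : ∀ {m m′} {ι : Fin m → Fin n} {ι′ : Fin m′ → Fin n} →
    (∀ l → ∃ λ l′ → ι′ l′ ≡ ι l) → ∀ {i} → Minimal ι′ i → Minimal ι i
  Minimal-⊆ ι⊆ι′ min (l , eq) = let l′ , eq′ = ι⊆ι′ l in min (l′ , trans eq (cong suc (sym eq′)))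

  UpClosed-remove : ∀ {m} {ι : Fin (suc m) → Fin n} {j} → UpClosed ι → Minimal ι (ι j) → UpClosed (ι ∘ punchIn j)
  UpClosed-remove {ι = ι} {j} up min {i} {k} eq with up eq
  ... | l , refl with j ≟ l
  ...   | yes refl = contradiction (punchIn j k , eq) min
  ...   | no j≢l   = punchOut j≢l , cong ι (punchIn-punchOut j≢l)

module ForestSum {c ℓ₁ ℓ₂} (K : OrderedField c ℓ₁ ℓ₂) {n : ℕ}
  (parent : Fin n → Fin (suc n)) where

  open OrderedFieldProperties K
  open PathProducts K
  open Forest parent

  -- The indicator that `u` lists every vertex after its parent, in a form that factors letter by
  -- letter as `pathProduct` does.
  extends : ∀ {m} → (Fin m → Fin n) → Carrier
  extends {zero}  u = 1#
  extends {suc m} u = 𝟙 (does (minimal? u (u zero))) · extends (u ∘ suc)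

  minimal?-⇔ : ∀ {m m′} {ι : Fin m → Fin n} {ι′ : Fin m′ → Fin n} →
    (∀ l → ∃ λ l′ → ι′ l′ ≡ ι l) → (∀ l → ∃ λ l′ → ι l′ ≡ ι′ l) →
    ∀ {i i′} → i ≡ i′ → does (minimal? ι i) ≡ does (minimal? ι′ i′)
  minimal?-⇔ {ι = ι} {ι′} ι⊆ι′ ι′⊆ι {i} refl =
    does-⇔ (mk⇔ (Minimal-⊆ ι′⊆ι) (Minimal-⊆ ι⊆ι′)) (minimal? ι i) (minimal? ι′ i)

  extends-cong : ∀ {m} {u u′ : Fin m → Fin n} → u ≗ u′ → extends u ≈ extends u′
  extends-cong {zero}  eq = ≈-refl
  extends-cong {suc m} {u} {u′} eq = *-cong
    (reflexive (cong 𝟙 (minimal?-⇔ {ι = u} {ι′ = u′} (λ l → l , sym (eq l)) (λ l → l , eq l) (eq zero))))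
    (extends-cong (eq ∘ suc))

  -- The first hypothesis is what remains of v = Σ_j f_j (e_j − e_{parent j}) after
  -- summing over an up-closed set: only edges entering the set contribute.
  module _ (v f : Fin n → Carrier)
    (minimal-sum : ∀ {m} (ι : Fin m → Fin n) → (∀ {k l} → ι k ≡ ι l → k ≡ l) → UpClosed ι →
      sum (v ∘ ι) ≈ sum (λ k → if does (minimal? ι (ι k)) then f (ι k) else 0#))
    (minimal-exists : ∀ {m} (ι : Fin (suc m) → Fin n) → ∃ λ k → Minimal ι (ι k)) where

    word : ∀ {m} → ℕ → (Fin m → Fin n) → Carrier
    word p u = pathProduct p (label ∘ u) (v ∘ u)

    parentFactor : Fin n → Carrier
    parentFactor i = factor (toℕ (parent i)) (label i) (f i)

    forestFactor : ∀ {m} → (Fin m → Fin n) → ℕ → Fin m → Carrier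
    forestFactor ι = siblingFactor (λ k → does (minimal? ι (ι k))) (label ∘ ι) (f ∘ ι) (parentFactor ∘ ι)

    if-yes : ∀ {p} {P : Set p} (P? : Dec P) {x y : Carrier} → P → (if does P? then x else y) ≈ x
    if-yes P? p = reflexive (cong (if_then _ else _) (dec-true P? p))

    if-no : ∀ {p} {P : Set p} (P? : Dec P) {x y : Carrier} → ¬ P → (if does P? then x else y) ≈ y
    if-no P? ¬p = reflexive (cong (if_then _ else _) (dec-false P? ¬p))

    -- Removing `ι j` makes exactly its children newly minimal, and the constant factor of a child
    -- of `ι j` already is that of an edge leaving `ι j`.
    forestFactor-remove : ∀ {m} (ι : Fin (suc m) → Fin n) → (∀ {k l} → ι k ≡ ι l → k ≡ l) →
      ∀ j k → forestFactor ι (label (ι j)) (punchIn j k) ≈ forestFactor (ι ∘ punchIn j) (label (ι j)) k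
    forestFactor-remove ι inj j k = by-cases (minimal? ι i) (minimal? (ι ∘ punchIn j) i)
      where
      i = ι (punchIn j k)
      by-cases : Dec (Minimal ι i) → Dec (Minimal (ι ∘ punchIn j) i) →
        forestFactor ι (label (ι j)) (punchIn j k) ≈ forestFactor (ι ∘ punchIn j) (label (ι j)) k
      by-cases (yes min) (yes min′) = ≈-trans (if-yes (minimal? ι i) min) (≈-sym (if-yes (minimal? (ι ∘ punchIn j) i) min′))
      by-cases (yes min) (no ¬min′) = contradiction (Minimal-⊆ (λ l → punchIn j l , refl) min) ¬min′
      by-cases (no ¬min) (no ¬min′) = ≈-trans (if-no (minimal? ι i) ¬min) (≈-sym (if-no (minimal? (ι ∘ punchIn j) i) ¬min′))
      by-cases (no ¬min) (yes min′) = ≈-trans (if-no (minimal? ι i) ¬min)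
          (≈-trans parent-j (≈-sym (if-yes (minimal? (ι ∘ punchIn j) i) min′)))
        where
        parent-j : parentFactor i ≈ factor (label (ι j)) (label i) (f i)
        parent-j with any? (λ l → parent i ≟ suc (ι l))
        ... | no none = contradiction none ¬min
        ... | yes (l , eq) with j ≟ l
        ...   | yes refl = reflexive (cong (λ p → factor (toℕ p) (label i) (f i)) eq)
        ...   | no j≢l   = contradiction (punchOut j≢l , trans eq (cong (suc ∘ ι) (sym (punchIn-punchOut j≢l)))) min′

    -- `one-step` on the right matches the choice of the first letter on the left; what it leaves is
    -- the same product for the remaining forest, started at that letter.
    forest-sum : ∀ {m} (ι : Fin m → Fin n) → (∀ {k l} → ι k ≡ ι l → k ≡ l) → UpClosed ι → ∀ p →
      ∑ (permutations m) (λ π → extends (ι ∘ (π ⟨$⟩ʳ_)) · word p (ι ∘ (π ⟨$⟩ʳ_))) ≈ ∏ (forestFactor ι p)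
    forest-sum {zero}  ι inj up p = ≈-trans (+-identityʳ _) (*-identityˡ 1#)
    forest-sum {suc m} ι inj up p = begin
      ∑ (permutations (suc m)) summand
        ≈⟨ ∑-permutations summand ⟩
      sum (λ j → ∑ (permutations m) (summand ∘ insert zero j))
        ≈⟨ sum-cong-≋ {x = λ j → ∑ (permutations m) (summand ∘ insert zero j)} {y = λ j → h j · Π j} first ⟩
      sum (λ j → h j · Π j)
        ≈⟨ one-step (λ k → does (minimal? ι (ι k))) (label ∘ ι) (f ∘ ι) (parentFactor ∘ ι) label-inj
             (let k , min = minimal-exists ι in k , dec-true (minimal? ι (ι k)) min) p ⟨
      ∏ (forestFactor ι p) ∎
      where
      open ≈-Reasoning

      label-inj : ∀ {j k} → label (ι j) ≡ label (ι k) → j ≡ k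
      label-inj = inj ∘ toℕ-injective ∘ ℕₚ.suc-injective

      summand : Permutation′ (suc m) → Carrier
      summand π = extends (ι ∘ (π ⟨$⟩ʳ_)) · word p (ι ∘ (π ⟨$⟩ʳ_))

      t = total (λ k → does (minimal? ι (ι k))) (f ∘ ι)

      h Π : Fin (suc m) → Carrier
      h = choice (λ k → does (minimal? ι (ι k))) (label ∘ ι) t p
      Π j = ∏ (forestFactor ι (label (ι j)) ∘ punchIn j)

      u : Fin (suc m) → Permutation′ m → Fin m → Fin n
      u j π k = ι (punchIn j (π ⟨$⟩ʳ k))

      peel : ∀ j π → summand (insert zero j π) ≈
        (𝟙 (does (minimal? ι (ι j))) · factor p (label (ι j)) t) · (extends (u j π) · word (label (ι j)) (u j π))
      peel j π = begin
        (𝟙 (does (minimal? u′ (ι j))) · extends (u′ ∘ suc)) · (factor p (label (ι j)) (sum (v ∘ u′)) · word (label (ι j)) (u′ ∘ suc))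
          ≈⟨ *-cong
               (*-cong (reflexive (cong 𝟙 (minimal?-⇔ {ι = u′} {ι′ = ι} (λ l → insert zero j π ⟨$⟩ʳ l , refl)
                 (λ l → insert zero j π ⟨$⟩ˡ l , cong ι (Perm.inverseʳ (insert zero j π))) refl)))
                 (extends-cong u′-suc))
               -- The sum over all letters is independent of their order, and `minimal-sum` makes it
               -- the total flow into the minimal ones.
               (*-cong (factor-cong p (label (ι j)) (≈-trans (≈-sym (sum-permute (v ∘ ι) (insert zero j π))) (minimal-sum ι inj up)))
                 (pathProduct-cong (label (ι j)) (cong label ∘ u′-suc) (λ k → reflexive (cong v (u′-suc k))))) ⟩
        (𝟙 (does (minimal? ι (ι j))) · extends (u j π)) · (factor p (label (ι j)) t · word (label (ι j)) (u j π))
          ≈⟨ solve 4 (λ a b c d → (a :* b) :* (c :* d) := (a :* c) :* (b :* d)) ≈-refl _ _ _ _ ⟩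
        (𝟙 (does (minimal? ι (ι j))) · factor p (label (ι j)) t) · (extends (u j π) · word (label (ι j)) (u j π)) ∎
        where
        u′ = ι ∘ (insert zero j π ⟨$⟩ʳ_)
        u′-suc : ∀ k → u′ (suc k) ≡ u j π k
        u′-suc k = cong ι (insert-suc j π k)

      first : ∀ j → ∑ (permutations m) (summand ∘ insert zero j) ≈ h j · Π j
      first j = begin
        ∑ (permutations m) (summand ∘ insert zero j)
          ≈⟨ ∑-cong (peel j) (permutations m) ⟩
        ∑ (permutations m) (λ π → w · (extends (u j π) · word (label (ι j)) (u j π)))
          ≈⟨ ∑-distribˡ w _ (permutations m) ⟨
        w · ∑ (permutations m) (λ π → extends (u j π) · word (label (ι j)) (u j π))
          ≈⟨ last ⟩
        h j · Π j ∎
        where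
        w = 𝟙 (does (minimal? ι (ι j))) · factor p (label (ι j)) t
        last : w · ∑ (permutations m) (λ π → extends (u j π) · word (label (ι j)) (u j π)) ≈ h j · Π j
        last with minimal? ι (ι j)
        ... | yes min = *-cong (≈-trans (*-congʳ (if-yes (minimal? ι (ι j)) min)) (≈-trans (*-identityˡ _) (≈-sym (if-yes (minimal? ι (ι j)) min))))
              (≈-trans (forest-sum (ι ∘ punchIn j) (punchIn-injective j _ _ ∘ inj) (UpClosed-remove up min) (label (ι j)))
                (∏-cong {x = forestFactor (ι ∘ punchIn j) (label (ι j))} {y = forestFactor ι (label (ι j)) ∘ punchIn j}
                  (λ k → ≈-sym (forestFactor-remove ι inj j k))))
        ... | no ¬min = ≈-trans (*-congʳ (≈-trans (*-congʳ (if-no (minimal? ι (ι j)) ¬min)) (zeroˡ _))) (≈-trans (zeroˡ _)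
              (≈-sym (≈-trans (*-congʳ (if-no (minimal? ι (ι j)) ¬min)) (zeroˡ _))))

-- Linear independence of the path products.

-- The two cases differ on p ≡ q so that factor p q vanishes exactly when the
-- flow has the sign given by up and q is not reached from p in that direction.
Toward : Bool → ℕ → ℕ → Set
Toward true  p q = p ℕ.≤ q
Toward false p q = q ℕ.< p

toward? : ∀ up p q → Dec (Toward up p q)
toward? true  p q = p ℕₚ.≤? q
toward? false p q = q ℕₚ.<? p

toward-trans : ∀ up {p q r} → Toward up p q → Toward up q r → Toward up p r
toward-trans true  p≤q q≤r = ℕₚ.≤-trans p≤q q≤r
toward-trans false q<p r<q = ℕₚ.<-trans r<q q<p

toward-some : ∀ p q → ∃ λ up → Toward up p q
toward-some p q with p ℕₚ.≤? q
... | yes p≤q = true  , p≤q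
... | no  p≰q = false , ℕₚ.≰⇒> p≰q

-- This is what lets `by-distance` treat the first letters between `p` and `r` before `r`.
toward-closer : ∀ up {p q r} → Toward up p q → Toward up q r → q ≢ r → ∣ q - p ∣ ℕ.< ∣ r - p ∣
toward-closer true {p} {q} {r} p≤q q≤r q≢r =
  ≡.subst₂ ℕ._<_ (sym (ℕₚ.m≤n⇒∣n-m∣≡n∸m p≤q)) (sym (ℕₚ.m≤n⇒∣n-m∣≡n∸m (ℕₚ.≤-trans p≤q q≤r)))
    (ℕₚ.∸-monoˡ-< (ℕₚ.≤∧≢⇒< q≤r q≢r) p≤q)
toward-closer false {p} {q} {r} q<p r<q q≢r =
  ≡.subst₂ ℕ._<_ (sym (ℕₚ.m≤n⇒∣m-n∣≡n∸m (ℕₚ.<⇒≤ q<p))) (sym (ℕₚ.m≤n⇒∣m-n∣≡n∸m (ℕₚ.<⇒≤ (ℕₚ.<-trans r<q q<p))))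
    (ℕₚ.∸-monoʳ-< r<q (ℕₚ.<⇒≤ q<p))

module LinearIndependence {c ℓ₁ ℓ₂} (K : OrderedField c ℓ₁ ℓ₂) where

  open OrderedFieldProperties K
  open PathProducts K

  ±1 : Bool → Carrier
  ±1 true  = 1#
  ±1 false = - 1#

  ±1² : ∀ up → ±1 up · ±1 up ≈ 1#
  ±1² true  = *-identityˡ 1#
  ±1² false = -1²

  factor-toward : ∀ up {p q x} → 0# < ±1 up · x → Toward up p q → factor p q x ≈ ±1 up
  factor-toward true  0<x p≤q = ≈-trans (+-cong (θ-pos (<-respʳ-≈ (*-identityˡ _) 0<x)) (δ-≮ (ℕₚ.≤⇒≯ p≤q))) (+-identityʳ _)
  factor-toward false 0<-x q<p = ≈-trans (+-cong (θ-≤0 x≤0) (δ-< q<p)) (+-identityˡ _)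
    where
    x≤0 : _ ≤ 0#
    x≤0 = ≤.trans (≤.reflexive (≈-sym (≈-trans (-‿cong (-1*x≈-x _)) (-‿involutive _)))) (0≤⇒-≤0 (<⇒≤ 0<-x))

  factor-away : ∀ up {p q x} → 0# < ±1 up · x → ¬ Toward up p q → factor p q x ≈ 0#
  factor-away true  0<x p≰q = ≈-trans (+-cong (θ-pos (<-respʳ-≈ (*-identityˡ _) 0<x)) (δ-< (ℕₚ.≰⇒> p≰q))) (-‿inverseʳ 1#)
  factor-away false 0<-x q≮p = ≈-trans (+-cong (θ-≤0 x≤0) (δ-≮ q≮p)) (+-identityˡ _)
    where
    x≤0 : _ ≤ 0#
    x≤0 = ≤.trans (≤.reflexive (≈-sym (≈-trans (-‿cong (-1*x≈-x _)) (-‿involutive _)))) (0≤⇒-≤0 (<⇒≤ 0<-x))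

  -- The other entries are bounded only against the direction `up`. The condition passes to every
  -- selection of entries that keeps `d`, so each tail of a word still containing `d` has a sum of
  -- the prescribed sign.
  record Dominates (up : Bool) {m} (x : Fin m → Carrier) (d : Fin m) : Set (c ⊔ ℓ₂) where
    constructor dominates
    field
      bound    : Carrier
      0≤bound  : 0# ≤ bound
      others   : ∀ k → k ≢ d → 0# ≤ ±1 up · x k + bound
      dominant : sum {m} (λ _ → bound) < ±1 up · x d

  sum-nonNegative : ∀ {m} (x : Fin m → Carrier) → (∀ k → 0# ≤ x k) → 0# ≤ sum x
  sum-nonNegative {zero}  x 0≤x = ≤.refl
  sum-nonNegative {suc m} x 0≤x = ≤.trans (≤.reflexive (≈-sym (+-identityˡ 0#)))
    (+-mono-≤ (0≤x zero) (sum-nonNegative (x ∘ suc) (0≤x ∘ suc)))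

  sum-const-suc : ∀ {m b} → 0# ≤ b → sum {m} (λ _ → b) ≤ sum {suc m} (λ _ → b)
  sum-const-suc {m} {b} 0≤b = ≤.trans (≤.reflexive (≈-sym (+-identityˡ (sum {m} (λ _ → b))))) (+-mono-≤ 0≤b ≤.refl)

  -- Adding `bound` to every other entry makes them nonnegative, and the total amount added stays
  -- below the dominant entry.
  dominates⇒sign : ∀ up {m} (x : Fin m → Carrier) d → Dominates up x d → 0# < ±1 up · sum x
  dominates⇒sign up {suc m} x d (dominates b 0≤b others dominant) =
    <-respʳ-≈ (≈-sym (≈-trans (*-distribˡ-sum (±1 up) x) (sum-remove {i = d} z)))
      λ le → +-mono-<-≤ (≤-<-trans (sum-const-suc {m} 0≤b) dominant) 0≤rest
        (≤.trans (≤.reflexive (≈-sym (+-assoc _ _ _))) (≤.trans (+-monoˡ-≤ B le) (≤.reflexive (+-comm 0# B))))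
    where
    z : Fin (suc m) → Carrier
    z k = ±1 up · x k
    B = sum {m} (λ _ → b)
    0≤rest : 0# ≤ sum (z ∘ punchIn d) + B
    0≤rest = ≤.trans (sum-nonNegative (λ k → z (punchIn d k) + b) (λ k → others (punchIn d k) (punchInᵢ≢i d k)))
      (≤.reflexive (∑-distrib-+ (z ∘ punchIn d) (λ _ → b)))

  dominates-restrict : ∀ up {m} (x : Fin (suc m) → Carrier) d (ι : Fin m → Fin (suc m)) d′ → ι d′ ≡ d →
    (∀ k → k ≢ d′ → ι k ≢ d) → Dominates up x d → Dominates up (x ∘ ι) d′
  dominates-restrict up {m} x d ι d′ refl ι≢ (dominates b 0≤b others dominant) =
    dominates b 0≤b (λ k k≢ → others (ι k) (ι≢ k k≢))
      (≤-<-trans (sum-const-suc {m} 0≤b) dominant)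

  -- While the dominating entry d is still to come, the word moves monotonically
  -- in the direction up; so it cannot reach d from beyond.
  pathProduct-beyond : ∀ up {m} p (lab : Fin m → ℕ) (x : Fin m → Carrier) d → Dominates up x d →
    ¬ Toward up p (lab d) → pathProduct p lab x ≈ 0#
  pathProduct-beyond up {suc m} p lab x d dom away with toward? up p (lab zero)
  ... | no ¬t = ≈-trans (*-congʳ (factor-away up (dominates⇒sign up x d dom) ¬t)) (zeroˡ _)
  pathProduct-beyond up {suc m} p lab x zero dom away | yes t = contradiction t away
  pathProduct-beyond up {suc m} p lab x (suc d) dom away | yes t = ≈-trans
    (*-congˡ (pathProduct-beyond up (lab zero) (lab ∘ suc) (x ∘ suc) d
      (dominates-restrict up x (suc d) suc d refl (λ { k k≢ refl → k≢ refl }) dom)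
      (away ∘ toward-trans up t))) (zeroʳ _)

  upperBound : ∀ xs → ∃ λ t → All (_< t) xs
  upperBound xs = let t , xs≤t = weak xs in t + 1# , All.map (λ x≤t → ≤-<-trans x≤t (x<x+1 t)) xs≤t
    where
    weak : ∀ xs → ∃ λ t → All (_≤ t) xs
    weak [] = 0# , []
    weak (x ∷ xs) with weak xs
    ... | t , xs≤t with ≤.total x t
    ...   | inj₁ x≤t = t , x≤t ∷ xs≤t
    ...   | inj₂ t≤x = x , ≤.refl ∷ All.map (λ y≤t → ≤.trans y≤t t≤x) xs≤t

  Nonzero : ∀ {m} → Vector Carrier m → Set ℓ₁
  Nonzero a = ¬ (∀ k → a k ≈ 0#)

  -- Conditional on `Nonzero`, because a nonzero normal may become zero when its coordinate `j` is
  -- dropped.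
  Avoids : ∀ {m} → Vector Carrier m → Vector Carrier m → Set ℓ₁
  Avoids x a = Nonzero a → ¬ sum (λ k → a k · x k) ≈ 0#

  sum-insertAt : ∀ {m} (a : Vector Carrier (suc m)) (x : Vector Carrier m) j y →
    sum (λ k → a k · insertAt x j y k) ≈ a j · y + sum (λ k → a (punchIn j k) · x k)
  sum-insertAt a x j y = ≈-trans (sum-remove {i = j} (λ k → a k · insertAt x j y k))
    (+-cong (*-congˡ (reflexive (insertAt-lookup x j y)))
      (sum-cong-≋ (λ k → *-congˡ {a (punchIn j k)} (reflexive (insertAt-punchIn x j y k)))))

  -- The value at `j` that would place the extended vector on the hyperplane of `a`.
  forbidden : ∀ {m} → Vector Carrier m → Fin (suc m) → Vector Carrier (suc m) → Carrier
  forbidden x j a with a j ≈? 0#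
  -- Here `a` puts the whole condition on `x`; the value is an arbitrary default.
  ... | yes _  = 0#
  ... | no a≉0 = - (proj₁ (inverse (a j) a≉0) · sum (λ k → a (punchIn j k) · x k))

  insertAt-avoids : ∀ {m} (a : Vector Carrier (suc m)) (x : Vector Carrier m) j y →
    Avoids x (a ∘ punchIn j) → ¬ y ≈ forbidden x j a → Avoids (insertAt x j y) a
  insertAt-avoids a x j y avoids y≉ a≢0 eq with a j ≈? 0#
  ... | yes a≈0 = avoids
    (λ zeros → a≢0 (λ k → all-zero zeros k))
    (≈-trans (≈-sym (≈-trans (+-congʳ (≈-trans (*-congʳ a≈0) (zeroˡ y))) (+-identityˡ _))) (≈-trans (≈-sym (sum-insertAt a x j y)) eq))
    where
    all-zero : (∀ k → a (punchIn j k) ≈ 0#) → ∀ k → a k ≈ 0#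
    all-zero zeros k with j ≟ k
    ... | yes refl = a≈0
    ... | no j≢k   = subst (λ l → a l ≈ 0#) (punchIn-punchOut j≢k) (zeros (punchOut j≢k))
  ... | no a≉0 = y≉ (begin
      y                    ≈⟨ *-identityˡ y ⟨
      1# · y               ≈⟨ *-congʳ (≈-trans (*-comm i (a j)) (proj₂ (inverse (a j) a≉0))) ⟨
      i · a j · y          ≈⟨ *-assoc i (a j) y ⟩
      i · (a j · y)        ≈⟨ *-congˡ (+-inverseˡ-unique (a j · y) r (≈-trans (≈-sym (sum-insertAt a x j y)) eq)) ⟩
      i · - r              ≈⟨ -‿distribʳ-* i r ⟨
      - (i · r)            ∎)
    where
    open ≈-Reasoning
    i = proj₁ (inverse (a j) a≉0)
    r = sum (λ k → a (punchIn j k) · x k)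

  ±1-cancel : ∀ up x → ±1 up · (±1 up · x) ≈ x
  ±1-cancel up x = ≈-trans (≈-sym (*-assoc _ _ _)) (≈-trans (*-congʳ (±1² up)) (*-identityˡ x))

  dominating-insert : ∀ up {m} (x : Vector Carrier m) j (as : List (Vector Carrier (suc m))) →
    All (Avoids x) (map (_∘ punchIn j) as) →
    ∃ λ y → Dominates up (insertAt x j y) j × All (Avoids (insertAt x j y)) as
  dominating-insert up {m} x j as avoids = y , dom , All.zipWith avoid (Allₚ.map⁻ avoids , Allₚ.map⁻ (All.tail <t))
    where
    -- The leading `0#` keeps the bound nonnegative.
    bounds = upperBound (0# ∷ tabulate (λ k → - (±1 up · x k)))
    b = proj₁ bounds
    B = sum {suc m} (λ _ → b)
    -- Exceeding `B` gives dominance, exceeding the other entries avoids every forbidden value.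
    bounds′ = upperBound (B ∷ map (λ a → ±1 up · forbidden x j a) as)
    t = proj₁ bounds′
    <t = proj₂ bounds′
    y = ±1 up · t
    dom : Dominates up (insertAt x j y) j
    dom = dominates b (<⇒≤ (All.head (proj₂ bounds))) others
      (<-respʳ-≈ (≈-sym (≈-trans (*-congˡ (reflexive (insertAt-lookup x j y))) (±1-cancel up t))) (All.head <t))
      where
      others : ∀ k → k ≢ j → 0# ≤ ±1 up · insertAt x j y k + b
      others k k≢j = ≤.trans (≤.reflexive (≈-sym (-‿inverseʳ z))) (+-mono-≤ (≤.reflexive (*-congˡ (reflexive
          (trans (sym (insertAt-punchIn x j y l)) (cong (insertAt x j y) (punchIn-punchOut (k≢j ∘ sym)))))))
          (<⇒≤ (Allₚ.tabulate⁻ (All.tail (proj₂ bounds)) l)))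
        where
        l = punchOut (k≢j ∘ sym)
        z = ±1 up · x l
    avoid : ∀ {a} → Avoids x (a ∘ punchIn j) × ±1 up · forbidden x j a < t → Avoids (insertAt x j y) a
    avoid {a} (av , lt) = insertAt-avoids a x j y av λ eq →
      lt (≤.reflexive (≈-trans (≈-sym (±1-cancel up t)) (*-congˡ eq)))

  insert-cong : ∀ {m} j {π ρ : Permutation′ m} → π Perm.≈ ρ → insert zero j π Perm.≈ insert zero j ρ
  insert-cong j eq zero    = refl
  insert-cong j {π} {ρ} eq (suc k) = trans (insert-suc j π k) (trans (cong (punchIn j) (eq k)) (sym (insert-suc j ρ k)))

  -- Start, labels and hyperplanes are arbitrary so that the induction can pass from `p` to the
  -- first letter `j`, to the labels other than that of `j`, and to normals without their coordinate
  -- `j`. A permutation is rebuilt from its first letter only up to `Perm._≈_`, which `b` must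
  -- respect.
  pathProduct-independent : ∀ {m} p (lab : Fin m → ℕ) → (∀ {j k} → lab j ≡ lab k → j ≡ k) →
    (b : Permutation′ m → Carrier) → b Preserves Perm._≈_ ⟶ _≈_ → (as : List (Vector Carrier m)) →
    (∀ x → All (Avoids x) as →
      ∑ (permutations m) (λ π → b π · pathProduct p (lab ∘ (π ⟨$⟩ʳ_)) (x ∘ (π ⟨$⟩ʳ_))) ≈ 0#) →
    ∀ π → b π ≈ 0#
  pathProduct-independent {zero} p lab inj b b-cong as vanish π = begin
    b π                     ≈⟨ b-cong (λ ()) ⟩
    b Perm.id               ≈⟨ *-identityʳ _ ⟨
    b Perm.id · 1#          ≈⟨ +-identityʳ _ ⟨
    b Perm.id · 1# + 0#     ≈⟨ vanish (λ ()) (All.universal (λ a a≢0 → contradiction (λ ()) a≢0) as) ⟩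
    0#                      ∎
    where open ≈-Reasoning
  pathProduct-independent {suc m} p lab inj b b-cong as vanish π = ≈-trans
    (b-cong (λ k → sym (insert-remove zero π k)))
    (by-distance _ (π ⟨$⟩ʳ zero) (ℕₚ.n<1+n _) (remove zero π))
    where
    open ≈-Reasoning
    dist : Fin (suc m) → ℕ
    dist j = ∣ lab j - p ∣

    -- For a given `j`, the coefficients of the words whose first letter is nearer to `p` already
    -- vanish.
    by-distance : ∀ d j → dist j ℕ.< d → ∀ ρ → b (insert zero j ρ) ≈ 0#
    by-distance (suc d) j j<d = pathProduct-independent (lab j) (lab ∘ punchIn j) (punchIn-injective j _ _ ∘ inj)
      (b ∘ insert zero j) (λ eq → b-cong (insert-cong j eq)) (map (_∘ punchIn j) as) restricted
      where
      up = proj₁ (toward-some p (lab j))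
      restricted : ∀ x → All (Avoids x) (map (_∘ punchIn j) as) →
        ∑ (permutations m) (λ ρ → b (insert zero j ρ) · pathProduct (lab j) (lab ∘ punchIn j ∘ (ρ ⟨$⟩ʳ_)) (x ∘ (ρ ⟨$⟩ʳ_))) ≈ 0#
      restricted x avoids = begin
        S                  ≈⟨ ±1-cancel up S ⟨
        ±1 up · (±1 up · S) ≈⟨ *-congˡ scaled ⟩
        ±1 up · 0#         ≈⟨ zeroʳ _ ⟩
        0#                 ∎
        where
        S = ∑ (permutations m) (λ ρ → b (insert zero j ρ) · pathProduct (lab j) (lab ∘ punchIn j ∘ (ρ ⟨$⟩ʳ_)) (x ∘ (ρ ⟨$⟩ʳ_)))
        extension = dominating-insert up x j as avoids
        y = proj₁ extension
        x⁺ = insertAt x j y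
        dom = proj₁ (proj₂ extension)

        summand : Permutation′ (suc m) → Carrier
        summand π = b π · pathProduct p (lab ∘ (π ⟨$⟩ʳ_)) (x⁺ ∘ (π ⟨$⟩ʳ_))

        peel : ∀ i ρ → summand (insert zero i ρ) ≈
          b (insert zero i ρ) · (factor p (lab i) (sum x⁺) · pathProduct (lab i) (lab ∘ punchIn i ∘ (ρ ⟨$⟩ʳ_)) (x⁺ ∘ punchIn i ∘ (ρ ⟨$⟩ʳ_)))
        peel i ρ = *-congˡ (*-cong (factor-cong p (lab i) (≈-sym (sum-permute x⁺ (insert zero i ρ))))
          (pathProduct-cong (lab i) (λ k → cong lab (insert-suc i ρ k)) (λ k → reflexive (cong x⁺ (insert-suc i ρ k)))))

        signed : 0# < ±1 up · sum x⁺
        signed = dominates⇒sign up x⁺ j dom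

        other : ∀ i → j ≢ i → ∀ ρ → summand (insert zero i ρ) ≈ 0#
        other i j≢i ρ = ≈-trans (peel i ρ) zero-factor
          where
          rest = pathProduct (lab i) (lab ∘ punchIn i ∘ (ρ ⟨$⟩ʳ_)) (x⁺ ∘ punchIn i ∘ (ρ ⟨$⟩ʳ_))
          j′ = punchOut (j≢i ∘ sym)
          d′ = ρ ⟨$⟩ˡ j′
          at-d′ : punchIn i (ρ ⟨$⟩ʳ d′) ≡ j
          at-d′ = trans (cong (punchIn i) (Perm.inverseʳ ρ)) (punchIn-punchOut (j≢i ∘ sym))
          only-d′ : ∀ k → k ≢ d′ → punchIn i (ρ ⟨$⟩ʳ k) ≢ j
          only-d′ k k≢ eq = k≢ (trans (sym (Perm.inverseˡ ρ)) (cong (ρ ⟨$⟩ˡ_)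
            (punchIn-injective i _ _ (trans eq (sym (punchIn-punchOut (j≢i ∘ sym)))))))
          zero-factor : b (insert zero i ρ) · (factor p (lab i) (sum x⁺) · rest) ≈ 0#
          zero-factor with toward? up p (lab i)
          ... | no away = ≈-trans (*-congˡ (≈-trans (*-congʳ (factor-away up signed away)) (zeroˡ rest))) (zeroʳ _)
          ... | yes p→i with toward? up (lab i) (lab j)
          -- The letter `i` lies between `p` and `j`, hence nearer to `p`: its coefficient is zero.
          ...   | yes i→j = ≈-trans (*-congʳ (by-distance d i (ℕₚ.<-≤-trans
                    (toward-closer up p→i i→j (λ eq → j≢i (sym (inj eq)))) (ℕₚ.≤-pred j<d)) ρ)) (zeroˡ _)
          -- The letter `i` lies beyond `j`: the rest of the word cannot come back to `j`.
          ...   | no beyond = ≈-trans (*-congˡ (≈-trans (*-congˡ (pathProduct-beyond up (lab i) _ _ d′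
                    (dominates-restrict up x⁺ j (punchIn i ∘ (ρ ⟨$⟩ʳ_)) d′ at-d′ only-d′ dom)
                    (subst (λ k → ¬ Toward up (lab i) (lab k)) (sym at-d′) beyond))) (zeroʳ _))) (zeroʳ _)

        -- The first factor is a constant sign, so what remains is a relation in `x` alone.
        own : ∀ ρ → summand (insert zero j ρ) ≈ ±1 up · (b (insert zero j ρ) · pathProduct (lab j) (lab ∘ punchIn j ∘ (ρ ⟨$⟩ʳ_)) (x ∘ (ρ ⟨$⟩ʳ_)))
        own ρ = ≈-trans (peel j ρ) (≈-trans
          (*-congˡ (*-cong (factor-toward up signed (proj₂ (toward-some p (lab j))))
            (pathProduct-cong (lab j) (λ _ → refl) (λ k → reflexive (insertAt-punchIn x j y (ρ ⟨$⟩ʳ k))))))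
          (solve 3 (λ u v w → u :* (v :* w) := v :* (u :* w)) ≈-refl _ _ _))

        column : Fin (suc m) → Carrier
        column i = ∑ (permutations m) (summand ∘ insert zero i)

        scaled : ±1 up · S ≈ 0#
        scaled = begin
          ±1 up · S                             ≈⟨ ∑-distribˡ (±1 up) _ (permutations m) ⟩
          _                                     ≈⟨ ∑-cong own (permutations m) ⟨
          column j                              ≈⟨ +-identityʳ _ ⟨
          column j + 0#                         ≈⟨ +-congˡ (sum-zero {f = column ∘ punchIn j} (λ k →
                                                     ≈-trans (∑-cong (other (punchIn j k) (punchInᵢ≢i j k ∘ sym)) (permutations m)) (∑-zero (permutations m)))) ⟨
          column j + sum (column ∘ punchIn j)   ≈⟨ sum-remove {i = j} column ⟨
          sum column                            ≈⟨ ∑-permutations summand ⟨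
          ∑ (permutations (suc m)) summand      ≈⟨ vanish x⁺ (proj₂ (proj₂ extension)) ⟩
          0#                                    ∎

-- Kronecker deltas and signs.

module Kronecker {c ℓ₁ ℓ₂} (K : OrderedField c ℓ₁ ℓ₂) where

  open OrderedFieldProperties K

  𝟙-yes : ∀ {p} {P : Set p} (P? : Dec P) → P → 𝟙 (does P?) ≈ 1#
  𝟙-yes P? p = reflexive (cong 𝟙 (dec-true P? p))

  𝟙-no : ∀ {p} {P : Set p} (P? : Dec P) → ¬ P → 𝟙 (does P?) ≈ 0#
  𝟙-no P? ¬p = reflexive (cong 𝟙 (dec-false P? ¬p))

  sum-𝟙 : ∀ {n} (f : Fin n → Carrier) i → sum (λ k → f k · 𝟙 (does (i ≟ k))) ≈ f i
  sum-𝟙 f zero    = ≈-trans (+-cong (*-identityʳ _) (sum-zero (λ k → zeroʳ (f (suc k))))) (+-identityʳ _)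
  sum-𝟙 f (suc i) = ≈-trans (+-cong (zeroʳ _) (sum-𝟙 (f ∘ suc) i)) (+-identityˡ _)

  ∏-zero : ∀ {n} (f : Fin n → Carrier) i → f i ≈ 0# → ∏ f ≈ 0#
  ∏-zero f zero    eq = ≈-trans (*-congʳ eq) (zeroˡ _)
  ∏-zero f (suc i) eq = ≈-trans (*-congˡ (∏-zero (f ∘ suc) i eq)) (zeroʳ _)

  ∏-one : ∀ {n} (f : Fin n → Carrier) → (∀ i → f i ≈ 1#) → ∏ f ≈ 1#
  ∏-one {zero}  f eq = ≈-refl
  ∏-one {suc n} f eq = ≈-trans (*-cong (eq zero) (∏-one (f ∘ suc) (eq ∘ suc))) (*-identityˡ 1#)

  negateIf : Bool → Carrier
  negateIf b = if b then - 1# else 1#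

  negateIf² : ∀ b → negateIf b · negateIf b ≈ 1#
  negateIf² true  = -1²
  negateIf² false = *-identityˡ 1#

  sign-length-filter : ∀ {a p n} {A : Set a} {P : Pred A p} (P? : Decidable P) (g : Fin n → A) →
    sign (length (filter P? (tabulate g))) ≈ ∏ (λ i → negateIf (does (P? (g i))))
  sign-length-filter {n = zero}  P? g = ≈-refl
  sign-length-filter {n = suc n} P? g with does (P? (g zero))
  ... | true  = *-congˡ (sign-length-filter P? (g ∘ suc))
  ... | false = ≈-trans (sign-length-filter P? (g ∘ suc)) (≈-sym (*-identityˡ _))

  sign² : ∀ m → sign m · sign m ≈ 1#
  sign² zero    = *-identityˡ 1#
  sign² (suc m) = ≈-trans (solve 2 (λ a b → (a :* b) :* (a :* b) := (a :* a) :* (b :* b)) ≈-refl (- 1#) (sign m))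
    (≈-trans (*-cong -1² (sign² m)) (*-identityˡ 1#))

  sign-cancel : ∀ m x → sign m · (sign m · x) ≈ x
  sign-cancel m x = ≈-trans (≈-sym (*-assoc _ _ _)) (≈-trans (*-congʳ (sign² m)) (*-identityˡ x))

-- Flows on a tree, its cone, and the tree product.

module TreeIndicator {c ℓ₁ ℓ₂} (K : OrderedField c ℓ₁ ℓ₂) {n : ℕ} (T : SpanningTree n) where

  open OrderedFieldProperties K
  open PathProducts K
  open Kronecker K
  open SpanningTree T using (edges; distortion; _→ₒₙ?_)
  open Rooted T
  open Forest parent using (Minimal; minimal?; UpClosed)
  open ForestSum K parent using (extends; forest-sum)

  -- The indicator of the subtree at `suc j`. It serves both as dual basis vector to `rootedEdge j`
  -- and as normal of the hyperplane where the flow at `j` vanishes.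
  below : Fin n → Vector Carrier n
  below j y = 𝟙 (does (suc j ≼? suc y))

  flow : Vector Carrier n → Fin n → Carrier
  flow v j = sum (λ y → below j y · v y)

  rootedEdge : Fin n → Vector Carrier n
  rootedEdge j = edgeVector (parent j , suc j)

  ¬≼zero : ∀ j → ¬ suc j ≼ zero
  ¬≼zero j m with subst (suc j ∈_) ancestors-zero m
  ... | here ()
  ... | there ()

  𝟙-≼-suc : ∀ j i → below j i ≈ 𝟙 (does (j ≟ i)) + 𝟙 (does (suc j ≼? parent i))
  𝟙-≼-suc j i with j ≟ i
  ... | yes refl = ≈-trans (𝟙-yes (suc j ≼? suc j) (self∈ancestors (suc j)))
        (≈-sym (≈-trans (+-congˡ (𝟙-no (suc j ≼? parent j) (child∉ancestors j))) (+-identityʳ 1#)))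
  ... | no j≢i = ≈-trans (reflexive (cong 𝟙 (does-⇔ (mk⇔ to ≼-suc⁺) (suc j ≼? suc i) (suc j ≼? parent i))))
        (≈-sym (+-identityˡ _))
    where
    to : suc j ≼ suc i → suc j ≼ parent i
    to m with ≼-suc⁻ m
    ... | inj₁ refl = contradiction refl j≢i
    ... | inj₂ m′   = m′

  -- The edge vectors on the path from 0 to `x` telescope.
  e-path : ∀ k x → e x k ≈ sum (λ j → 𝟙 (does (suc j ≼? x)) · rootedEdge j k)
  e-path k = parent-induction _ base step
    where
    open ≈-Reasoning
    base : 0# ≈ sum (λ j → 𝟙 (does (suc j ≼? zero)) · rootedEdge j k)
    base = ≈-sym (sum-zero (λ j → ≈-trans (*-congʳ (𝟙-no (suc j ≼? zero) (¬≼zero j))) (zeroˡ (rootedEdge j k))))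
    step : ∀ i → e (parent i) k ≈ sum (λ j → 𝟙 (does (suc j ≼? parent i)) · rootedEdge j k) →
      e (suc i) k ≈ sum (λ j → below j i · rootedEdge j k)
    step i IH = begin
      e (suc i) k
        ≈⟨ ≈-trans (+-assoc _ _ _) (≈-trans (+-congˡ (-‿inverseˡ _)) (+-identityʳ _)) ⟨
      rootedEdge i k + e (parent i) k
        ≈⟨ +-cong (≈-sym (sum-𝟙 (λ j → rootedEdge j k) i)) IH ⟩
      sum (λ j → rootedEdge j k · 𝟙 (does (i ≟ j))) + sum (λ j → 𝟙 (does (suc j ≼? parent i)) · rootedEdge j k)
        ≈⟨ ∑-distrib-+ (λ j → rootedEdge j k · 𝟙 (does (i ≟ j))) (λ j → 𝟙 (does (suc j ≼? parent i)) · rootedEdge j k) ⟨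
      sum (λ j → rootedEdge j k · 𝟙 (does (i ≟ j)) + 𝟙 (does (suc j ≼? parent i)) · rootedEdge j k)
        ≈⟨ sum-cong-≋ (λ j → ≈-trans (+-congʳ (≈-trans (*-comm _ _)
             (*-congʳ (reflexive (cong 𝟙 (does-⇔ (mk⇔ sym sym) (i ≟ j) (j ≟ i)))))))
             (≈-trans (≈-sym (distribʳ _ _ _)) (*-congʳ {rootedEdge j k} (≈-sym (𝟙-≼-suc j i))))) ⟩
      sum (λ j → below j i · rootedEdge j k) ∎

  flow-expansion : ∀ v k → v k ≈ sum (λ j → flow v j · rootedEdge j k)
  flow-expansion v k = begin
    v k
      ≈⟨ sum-𝟙 v k ⟨
    sum (λ y → v y · 𝟙 (does (k ≟ y)))
      ≈⟨ sum-cong-≋ (λ y → *-congˡ {v y} (≈-trans (reflexive (cong 𝟙 (does-⇔ (mk⇔ sym sym) (k ≟ y) (y ≟ k)))) (e-path k (suc y)))) ⟩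
    sum (λ y → v y · sum (λ j → below j y · rootedEdge j k))
      ≈⟨ sum-cong-≋ (λ y → *-distribˡ-sum (v y) (λ j → below j y · rootedEdge j k)) ⟩
    sum (λ y → sum (λ j → v y · (below j y · rootedEdge j k)))
      ≈⟨ ∑-comm (λ y j → v y · (below j y · rootedEdge j k)) ⟩
    sum (λ j → sum (λ y → v y · (below j y · rootedEdge j k)))
      ≈⟨ sum-cong-≋ (λ j → ≈-trans (sum-cong-≋ (λ y → solve 3 (λ a b c → a :* (b :* c) := (b :* a) :* c) ≈-refl (v y) (below j y) (rootedEdge j k)))
           (≈-sym (*-distribʳ-sum (rootedEdge j k) (λ y → below j y · v y)))) ⟩
    sum (λ j → flow v j · rootedEdge j k) ∎
    where open ≈-Reasoning

  sum-below-e : ∀ j x → sum (λ y → below j y · e x y) ≈ 𝟙 (does (suc j ≼? x))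
  sum-below-e j zero    = ≈-trans (sum-zero (λ y → zeroʳ (below j y))) (≈-sym (𝟙-no (suc j ≼? zero) (¬≼zero j)))
  sum-below-e j (suc i) = sum-𝟙 (below j) i

  -- Unless `i` is `j`, the ends of edge `i` are both inside or both outside the subtree at `suc j`.
  sum-below-rootedEdge : ∀ j i → sum (λ y → below j y · rootedEdge i y) ≈ 𝟙 (does (j ≟ i))
  sum-below-rootedEdge j i = begin
    sum (λ y → below j y · rootedEdge i y)
      ≈⟨ sum-cong-≋ (λ y → ≈-trans (distribˡ (below j y) _ _) (+-congˡ (*-congˡ (≈-sym (-1*x≈-x _))))) ⟩
    sum (λ y → below j y · e (suc i) y + below j y · (- 1# · e (parent i) y))
      ≈⟨ ∑-distrib-+ (λ y → below j y · e (suc i) y) (λ y → below j y · (- 1# · e (parent i) y)) ⟩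
    sum (λ y → below j y · e (suc i) y) + sum (λ y → below j y · (- 1# · e (parent i) y))
      ≈⟨ +-congˡ (sum-cong-≋ (λ y → solve 3 (λ a b c → a :* (b :* c) := b :* (a :* c)) ≈-refl (below j y) (- 1#) (e (parent i) y))) ⟩
    sum (λ y → below j y · e (suc i) y) + sum (λ y → - 1# · (below j y · e (parent i) y))
      ≈⟨ +-cong (sum-below-e j (suc i)) (≈-trans (≈-sym (*-distribˡ-sum (- 1#) (λ y → below j y · e (parent i) y))) (*-congˡ (sum-below-e j (parent i)))) ⟩
    below j i + - 1# · 𝟙 (does (suc j ≼? parent i))
      ≈⟨ +-cong (𝟙-≼-suc j i) (-1*x≈-x _) ⟩
    𝟙 (does (j ≟ i)) + 𝟙 (does (suc j ≼? parent i)) - 𝟙 (does (suc j ≼? parent i))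
      ≈⟨ ≈-trans (+-assoc _ _ _) (≈-trans (+-congˡ (-‿inverseʳ _)) (+-identityʳ _)) ⟩
    𝟙 (does (j ≟ i)) ∎
    where open ≈-Reasoning

  flow-unique : ∀ v (g : Fin n → Carrier) → (∀ k → v k ≈ sum (λ i → g i · rootedEdge i k)) → ∀ j → flow v j ≈ g j
  flow-unique v g eq j = begin
    sum (λ y → below j y · v y)
      ≈⟨ sum-cong-≋ (λ y → ≈-trans (*-congˡ {below j y} (eq y)) (*-distribˡ-sum (below j y) (λ i → g i · rootedEdge i y))) ⟩
    sum (λ y → sum (λ i → below j y · (g i · rootedEdge i y)))
      ≈⟨ ∑-comm (λ y i → below j y · (g i · rootedEdge i y)) ⟩
    sum (λ i → sum (λ y → below j y · (g i · rootedEdge i y)))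
      ≈⟨ sum-cong-≋ (λ i → ≈-trans (sum-cong-≋ (λ y → solve 3 (λ a b c → a :* (b :* c) := b :* (a :* c)) ≈-refl (below j y) (g i) (rootedEdge i y)))
           (≈-trans (≈-sym (*-distribˡ-sum (g i) (λ y → below j y · rootedEdge i y))) (*-congˡ (sum-below-rootedEdge j i)))) ⟩
    sum (λ i → g i · 𝟙 (does (j ≟ i)))
      ≈⟨ sum-𝟙 g j ⟩
    g j ∎
    where open ≈-Reasoning

  orientation : Fin n → Carrier
  orientation i = negateIf (does (suc i <? parent i))

  edgeVector-oriented : ∀ i k → edgeVector (orientedEdge i) k ≈ orientation i · rootedEdge i k
  edgeVector-oriented i k with does (suc i <? parent i)
  ... | true  = ≈-sym (≈-trans (-1*x≈-x _) (⁻¹-anti-homo‿- _ _))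
  ... | false = ≈-sym (*-identityˡ _)

  ∑-edges : ∀ (h : Fin (suc n) × Fin (suc n) → Carrier) → ∑ edges h ≈ sum (h ∘ orientedEdge)
  ∑-edges h = ≈-trans (∑-↭ h edges-↭) (≈-trans (∑-map h orientedEdge (allFin n)) (∑-tabulate (h ∘ orientedEdge) id))

  ∑-edges-rooted : ∀ (w : Fin (suc n) × Fin (suc n) → Carrier) k →
    ∑ edges (λ x → w x · edgeVector x k) ≈ sum (λ i → (w (orientedEdge i) · orientation i) · rootedEdge i k)
  ∑-edges-rooted w k = ≈-trans (∑-edges (λ x → w x · edgeVector x k))
    (sum-cong-≋ (λ i → ≈-trans (*-congˡ {w (orientedEdge i)} (edgeVector-oriented i k)) (≈-sym (*-assoc _ _ _))))

  -- An edge of G is its rooted version times `orientation`, so by uniqueness of the flow the weight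
  -- of an edge in any conic combination is the signed flow.
  pos⇒flow : ∀ {v} → pos T v → ∀ j → 0# ≤ orientation j · flow v j
  pos⇒flow {v} (w , 0≤w , eq) j = ≤.trans (0≤w (orientedEdge∈edges j)) (≤.reflexive (≈-sym (begin
    orientation j · flow v j
      ≈⟨ *-congˡ (flow-unique v _ (λ k → ≈-trans (eq k) (∑-edges-rooted w k)) j) ⟩
    orientation j · (w (orientedEdge j) · orientation j)
      ≈⟨ solve 2 (λ a b → a :* (b :* a) := b :* (a :* a)) ≈-refl (orientation j) (w (orientedEdge j)) ⟩
    w (orientedEdge j) · (orientation j · orientation j)
      ≈⟨ *-congˡ (negateIf² (does (suc j <? parent j))) ⟩
    w (orientedEdge j) · 1#
      ≈⟨ *-identityʳ _ ⟩
    w (orientedEdge j) ∎)))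
    where open ≈-Reasoning

  flow⇒pos : ∀ {v} → (∀ j → 0# ≤ orientation j · flow v j) → pos T v
  flow⇒pos {v} 0≤ = w , 0≤w , λ k → begin
    v k
      ≈⟨ flow-expansion v k ⟩
    sum (λ i → flow v i · rootedEdge i k)
      ≈⟨ sum-cong-≋ (λ i → *-congʳ {rootedEdge i k} (≈-sym (≈-trans (*-congʳ (w-edge i)) (≈-trans
           (solve 2 (λ a b → (a :* b) :* a := (a :* a) :* b) ≈-refl (orientation i) (flow v i))
           (≈-trans (*-congʳ (negateIf² (does (suc i <? parent i)))) (*-identityˡ _)))))) ⟩
    sum (λ i → (w (orientedEdge i) · orientation i) · rootedEdge i k)
      ≈⟨ ∑-edges-rooted w k ⟨
    ∑ edges (λ x → w x · edgeVector x k) ∎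
    where
    open ≈-Reasoning
    edge? : ∀ x → Dec (∃ λ i → x ≡ orientedEdge i)
    edge? x = any? λ i → Productₚ.≡-dec _≟_ _≟_ x (orientedEdge i)
    -- Weights are indexed by all pairs of vertices; off the tree the value is a filler.
    weight : ∀ {x} → Dec (∃ λ i → x ≡ orientedEdge i) → Carrier
    weight (yes (i , _)) = orientation i · flow v i
    weight (no _)        = 0#
    w : Fin (suc n) × Fin (suc n) → Carrier
    w x = weight (edge? x)
    w-edge : ∀ i → w (orientedEdge i) ≈ orientation i · flow v i
    w-edge i with edge? (orientedEdge i)
    ... | yes (j , eq) = reflexive (cong (λ j → orientation j · flow v j) (sym (orientedEdge-injective eq)))
    ... | no none      = contradiction (i , refl) none
    0≤w : ∀ {x} → x ∈ edges → 0# ≤ w x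
    0≤w m with edges∋⇒orientedEdge m
    ... | i , refl = ≤.trans (0≤ i) (≤.reflexive (≈-sym (w-edge i)))

  parentFactor : Vector Carrier n → Fin n → Carrier
  parentFactor v i = factor (toℕ (parent i)) (label i) (flow v i)

  treeProduct : Vector Carrier n → Carrier
  treeProduct v = ∏ (parentFactor v)

  sign-distortion : sign distortion ≈ ∏ orientation
  sign-distortion = begin
    sign (length (filter against? edges))
      ≈⟨ reflexive (cong sign (↭-length (filter-↭ against? edges-↭))) ⟩
    sign (length (filter against? (map orientedEdge (allFin n))))
      ≈⟨ reflexive (cong (sign ∘ length ∘ filter against?) (map-tabulate id orientedEdge)) ⟩
    sign (length (filter against? (tabulate orientedEdge)))
      ≈⟨ sign-length-filter against? orientedEdge ⟩
    ∏ (λ i → negateIf (does (against? (orientedEdge i))))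
      ≈⟨ ∏-cong (λ i → reflexive (cong negateIf (against-natural i))) ⟩
    ∏ orientation ∎
    where
    open ≈-Reasoning
    against? = λ ((i , j) : Fin (suc n) × Fin (suc n)) → j →ₒₙ? i

  orientation-yes : ∀ {j} → suc j Fin.< parent j → orientation j ≈ - 1#
  orientation-yes {j} lt = reflexive (cong negateIf (dec-true (suc j <? parent j) lt))

  orientation-no : ∀ {j} → ¬ suc j Fin.< parent j → orientation j ≈ 1#
  orientation-no {j} ≮ = reflexive (cong negateIf (dec-false (suc j <? parent j) ≮))

  oriented-factor-1 : ∀ v j → ¬ flow v j ≈ 0# → 0# ≤ orientation j · flow v j → orientation j · parentFactor v j ≈ 1#
  oriented-factor-1 v j f≉0 0≤ with suc j <? parent j
  ... | yes lt = ≈-trans (*-cong (orientation-yes lt) (≈-trans (+-cong (θ-≤0 f≤0) (δ-< lt)) (+-identityˡ _))) -1²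
    where
    f≤0 : flow v j ≤ 0#
    f≤0 = ≤.trans (≤.reflexive (≈-sym (≈-trans (-‿cong (≈-trans (*-congʳ (orientation-yes lt)) (-1*x≈-x _))) (-‿involutive _)))) (0≤⇒-≤0 0≤)
  ... | no ≮ = ≈-trans (*-cong (orientation-no ≮) (≈-trans (+-cong (θ-pos 0<f) (δ-≮ ≮)) (+-identityʳ _))) (*-identityˡ 1#)
    where
    0<f : 0# < flow v j
    0<f f≤0 = f≉0 (≤.antisym f≤0 (≤.trans 0≤ (≤.reflexive (≈-trans (*-congʳ (orientation-no ≮)) (*-identityˡ _)))))

  oriented-factor-0 : ∀ v j → ¬ 0# ≤ orientation j · flow v j → orientation j · parentFactor v j ≈ 0#
  oriented-factor-0 v j 0≰ with suc j <? parent j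
  ... | yes lt = ≈-trans (*-congˡ (≈-trans (+-cong (θ-pos 0<f) (δ-< lt)) (-‿inverseʳ 1#))) (zeroʳ _)
    where
    0<f : 0# < flow v j
    0<f f≤0 = 0≰ (≤.trans (≤0⇒0≤- f≤0) (≤.reflexive (≈-sym (≈-trans (*-congʳ (orientation-yes lt)) (-1*x≈-x _)))))
  ... | no ≮ = ≈-trans (*-congˡ (≈-trans (+-cong (θ-≤0 f≤0) (δ-≮ ≮)) (+-identityˡ 0#))) (zeroʳ _)
    where
    f≤0 : flow v j ≤ 0#
    f≤0 with ≤.total (flow v j) 0#
    ... | inj₁ le = le
    ... | inj₂ ge = contradiction (≤.trans ge (≤.reflexive (≈-sym (≈-trans (*-congʳ (orientation-no ≮)) (*-identityˡ _))))) 0≰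

  -- Where no flow vanishes, each factor times its orientation is 1 or 0 according to whether the
  -- signed flow is nonnegative; the orientations multiply to the sign of the distortion.
  indicator-formula : ∀ {χ : Vector Carrier n → Carrier} → IsIndicator (pos T) χ →
    ∀ v → (∀ j → ¬ flow v j ≈ 0#) → χ v ≈ sign distortion · treeProduct v
  indicator-formula {χ} ind v generic = ≈-trans value (≈-sym (≈-trans (*-congʳ sign-distortion)
    (≈-sym (∏-distrib-· orientation (parentFactor v)))))
    where
    value : χ v ≈ ∏ (λ j → orientation j · parentFactor v j)
    value with all? (λ j → 0# ≤? (orientation j · flow v j))
    ... | yes 0≤ = ≈-trans (proj₁ (ind v) (flow⇒pos 0≤)) (≈-sym (∏-one _ (λ j → oriented-factor-1 v j (generic j) (0≤ j))))
    ... | no ¬0≤ = let j , 0≰ = ¬∀⟶∃¬ n _ (λ j → 0# ≤? (orientation j · flow v j)) ¬0≤ in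
      ≈-trans (proj₂ (ind v) (λ p → 0≰ (pos⇒flow p j))) (≈-sym (∏-zero _ j (oriented-factor-0 v j 0≰)))

  -- Climb towards the root while the parent stays in the set; the root is not in it.
  minimal-exists : ∀ {m} (ι : Fin (suc m) → Fin n) → ∃ λ k → Minimal ι (ι k)
  minimal-exists ι = parent-induction (λ x → ∀ k → suc (ι k) ≡ x → ∃ λ k → Minimal ι (ι k)) (λ _ ()) step (suc (ι zero)) zero refl
    where
    step : ∀ i → (∀ k → suc (ι k) ≡ parent i → ∃ λ k → Minimal ι (ι k)) → ∀ k → suc (ι k) ≡ suc i → ∃ λ k → Minimal ι (ι k)
    step i IH k refl with any? (λ l → parent i ≟ suc (ι l))
    ... | yes (l , eq) = IH l (sym eq)
    ... | no none      = k , none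

  minimal-sum : ∀ v {m} (ι : Fin m → Fin n) → (∀ {k l} → ι k ≡ ι l → k ≡ l) → UpClosed ι →
    sum (v ∘ ι) ≈ sum (λ k → if does (minimal? ι (ι k)) then flow v (ι k) else 0#)
  minimal-sum v {m} ι inj up = begin
    sum (v ∘ ι)
      ≈⟨ sum-cong-≋ (λ k → flow-expansion v (ι k)) ⟩
    sum (λ k → sum (λ j → flow v j · rootedEdge j (ι k)))
      ≈⟨ ∑-comm (λ k j → flow v j · rootedEdge j (ι k)) ⟩
    sum (λ j → sum (λ k → flow v j · rootedEdge j (ι k)))
      ≈⟨ sum-cong-≋ (λ j → ≈-trans (≈-sym (*-distribˡ-sum (flow v j) (λ k → rootedEdge j (ι k)))) (≈-trans (*-congˡ {flow v j} (boundary j))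
           (≈-trans (solve 3 (λ a b c → a :* (b :* c) := (b :* a) :* c) ≈-refl (flow v j) (μ j) (occurs j)) (*-distribˡ-sum (μ j · flow v j) (λ k → 𝟙 (does (j ≟ ι k))))))) ⟩
    sum (λ j → sum (λ k → (μ j · flow v j) · 𝟙 (does (j ≟ ι k))))
      ≈⟨ ∑-comm (λ j k → (μ j · flow v j) · 𝟙 (does (j ≟ ι k))) ⟩
    sum (λ k → sum (λ j → (μ j · flow v j) · 𝟙 (does (j ≟ ι k))))
      ≈⟨ sum-cong-≋ (λ k → ≈-trans (sum-cong-≋ (λ j → *-congˡ {μ j · flow v j} (reflexive (cong 𝟙 (does-⇔ (mk⇔ sym sym) (j ≟ ι k) (ι k ≟ j))))))
           (≈-trans (sum-𝟙 (λ j → μ j · flow v j) (ι k)) (𝟙-if (does (minimal? ι (ι k)))))) ⟩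
    sum (λ k → if does (minimal? ι (ι k)) then flow v (ι k) else 0#) ∎
    where
    open ≈-Reasoning
    μ occurs : Fin n → Carrier
    μ j = 𝟙 (does (minimal? ι j))
    occurs j = sum (λ k → 𝟙 (does (j ≟ ι k)))

    𝟙-if : ∀ b {x} → 𝟙 b · x ≈ (if b then x else 0#)
    𝟙-if true  = *-identityˡ _
    𝟙-if false = zeroˡ _

    occurs-ι : ∀ l → occurs (ι l) ≈ 1#
    occurs-ι l = ≈-trans (sum-cong-≋ (λ k → ≈-trans (reflexive (cong 𝟙 (does-⇔ (mk⇔ inj (cong ι)) (ι l ≟ ι k) (l ≟ k)))) (≈-sym (*-identityˡ _))))
      (sum-𝟙 (λ _ → 1#) l)

    inside : Fin (suc n) → Carrier
    inside x = sum (λ k → e x (ι k))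

    inside-no : ∀ x → (∀ k → x ≢ suc (ι k)) → inside x ≈ 0#
    inside-no zero    _  = sum-replicate-zero m
    inside-no (suc i) x≢ = sum-zero (λ k → 𝟙-no (i ≟ ι k) (x≢ k ∘ cong suc))

    -- An edge entering the set counts once, one with both ends inside cancels, and up-closure
    -- excludes edges leaving the set.
    boundary : ∀ j → sum (λ k → rootedEdge j (ι k)) ≈ μ j · occurs j
    boundary j = begin
      sum (λ k → rootedEdge j (ι k))
        ≈⟨ sum-cong-≋ (λ k → +-congˡ {e (suc j) (ι k)} (≈-sym (-1*x≈-x (e (parent j) (ι k))))) ⟩
      sum (λ k → e (suc j) (ι k) + - 1# · e (parent j) (ι k))
        ≈⟨ ∑-distrib-+ (λ k → e (suc j) (ι k)) (λ k → - 1# · e (parent j) (ι k)) ⟩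
      occurs j + sum (λ k → - 1# · e (parent j) (ι k))
        ≈⟨ +-congˡ (*-distribˡ-sum (- 1#) (λ k → e (parent j) (ι k))) ⟨
      occurs j + - 1# · inside (parent j)
        ≈⟨ by-cases ⟩
      μ j · occurs j ∎
      where
      by-cases : occurs j + - 1# · inside (parent j) ≈ μ j · occurs j
      by-cases with any? (λ l → parent j ≟ suc (ι l))
      ... | no none = ≈-trans (+-congˡ (≈-trans (*-congˡ (inside-no (parent j) (λ k eq → none (k , eq)))) (zeroʳ _)))
            (≈-trans (+-identityʳ _) (≈-sym (*-identityˡ _)))
      ... | yes (l , eq) with up eq
      ...   | l′ , refl = ≈-trans (+-cong (occurs-ι l′) (≈-trans (*-congˡ (≈-trans (reflexive (cong inside eq)) (occurs-ι l))) (*-identityʳ _)))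
            (≈-trans (-‿inverseʳ 1#) (≈-sym (zeroˡ _)))

  treeProduct-expansion : ∀ v → treeProduct v ≈
    ∑ (permutations n) (λ s → extends (s ⟨$⟩ʳ_) · pathProduct 0 (label ∘ (s ⟨$⟩ʳ_)) (v ∘ (s ⟨$⟩ʳ_)))
  treeProduct-expansion v = ≈-sym (≈-trans
    (forest-sum v (flow v) (minimal-sum v) minimal-exists id id (λ {i} _ → i , refl) 0)
    (∏-cong rooted))
    where
    -- With all vertices present, the minimal ones are the children of the root, whose label is the
    -- start 0.
    rooted : ∀ k → (if does (minimal? id k) then factor 0 (label k) (flow v k) else parentFactor v k) ≈ parentFactor v k
    rooted k with any? (λ l → parent k ≟ suc l)
    ... | yes _   = ≈-refl
    ... | no none = reflexive (cong (λ p → factor p (label k) (flow v k)) (sym (root (parent k) none)))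
      where
      root : ∀ x → ¬ (∃ λ l → x ≡ suc l) → toℕ x ≡ 0
      root zero    _ = refl
      root (suc i) h = contradiction (i , refl) h

-- The tree order of a path tree.

module PathTree {n : ℕ} (s : Permutation′ n) where

  open Rooted (pathTree s)

  at : Fin (suc n) → Fin (suc n)
  at = lift₀ s ⟨$⟩ʳ_

  at-injective : ∀ {a b} → at a ≡ at b → a ≡ b
  at-injective eq = trans (sym (Perm.inverseˡ (lift₀ s))) (trans (cong (lift₀ s ⟨$⟩ˡ_) eq) (Perm.inverseˡ (lift₀ s)))

  ≼-zero : ∀ {i} → i ≼ zero → i ≡ zero
  ≼-zero {i} m with subst (i ∈_) ancestors-zero m
  ... | here refl = refl
  ... | there ()

  Ordered : Fin (suc n) → Set
  Ordered b = ∀ a → (at a ≼ at b → a Fin.≤ b) × (a Fin.≤ b → at a ≼ at b)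

  -- The order statement at the previous position keeps the new vertex off the path so far, so the
  -- two facts must be proved in one induction.
  ordered⇒ancestors : ∀ l → Ordered (inject₁ l) → ancestors (at (suc l)) ≡ ancestors (at (inject₁ l)) ∷ʳ at (suc l)
  ordered⇒ancestors l ordered = ancestors-child (fwd (l , refl , refl))
    λ m → ℕₚ.<-irrefl refl (subst (suc (toℕ l) ℕ.≤_) (toℕ-inject₁ l) (proj₁ (ordered (suc l)) m))

  ordered : ∀ b → Ordered b
  ordered = <-weakInduction Ordered
    (λ a → (λ m → subst (λ a → a Fin.≤ zero {n}) (sym (at-injective {a} {zero} (≼-zero m))) (z≤n {0})) ,
           (λ { le → subst (λ a → at a ≼ zero) (sym (Finₚ.toℕ-injective {i = a} {j = zero} (ℕₚ.n≤0⇒n≡0 le))) (self∈ancestors zero) }))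
    step
    where
    step : ∀ l → Ordered (inject₁ l) → Ordered (suc l)
    step l IH a = to , from
      where
      to : at a ≼ at (suc l) → a Fin.≤ suc l
      to m with ∈-++⁻ (ancestors (at (inject₁ l))) (subst (at a ∈_) (ordered⇒ancestors l IH) m)
      ... | inj₁ m′        = ℕₚ.m≤n⇒m≤1+n (subst (toℕ a ℕ.≤_) (toℕ-inject₁ l) (proj₁ (IH a) m′))
      ... | inj₂ (here eq) = ℕₚ.≤-reflexive (cong toℕ (at-injective {a} {suc l} eq))
      from : a Fin.≤ suc l → at a ≼ at (suc l)
      from le with a ≟ suc l
      ... | yes refl = self∈ancestors (at a)
      ... | no a≢ = subst (at a ∈_) (sym (ordered⇒ancestors l IH)) (∈-++⁺ˡ (proj₂ (IH a)
          (subst (toℕ a ℕ.≤_) (sym (toℕ-inject₁ l)) (ℕₚ.≤-pred (Finₚ.≤∧≢⇒< le a≢)))))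

  parent-at : ∀ l → parent (s ⟨$⟩ʳ l) ≡ at (inject₁ l)
  parent-at l with ancestors-∷ʳ⇒parent (ordered⇒ancestors l (ordered (inject₁ l)))
  ... | _ , refl , eq = sym eq

  ≼-rank : ∀ {i j} → i ≼ j → rank s i ℕ.≤ rank s j
  ≼-rank {i} {j} m = proj₁ (ordered (lift₀ s ⟨$⟩ˡ j) (lift₀ s ⟨$⟩ˡ i))
    (≡.subst₂ _≼_ (sym (Perm.inverseʳ (lift₀ s))) (sym (Perm.inverseʳ (lift₀ s))) m)

-- Compatibility with a path tree as linear extension.

module Compatibility {n : ℕ} (T : SpanningTree n) (s : Permutation′ n) where

  open Rooted T

  LinearExtension : ∀ {m} → (Fin m → Fin n) → Set
  LinearExtension u = ∀ k l → parent (u k) ≡ suc (u l) → l Fin.< k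

  -- A child listed before its parent would precede it in the path order and follow it in `T`,
  -- against asymmetry of the common order.
  compatible⇒linearExtension : Compatible T (pathTree s) → LinearExtension (s ⟨$⟩ʳ_)
  compatible⇒linearExtension (_<_ , sto , T⇒< , s⇒<) k l eq with l <? k
  ... | yes l<k = l<k
  ... | no l≮k = contradiction (s⇒< later) (asym (T⇒< earlier))
    where
    open IsStrictTotalOrder sto using (asym)
    i = s ⟨$⟩ʳ k
    j = s ⟨$⟩ʳ l
    j≢i : suc j ≢ suc i
    j≢i eq′ = parent≢ i (trans eq eq′)
    earlier : SpanningTree._≺_ T (suc j) (suc i)
    earlier = j≢i , ≼-suc⁺ (subst (_≼ parent i) eq (self∈ancestors (parent i)))
    later : SpanningTree._≺_ (pathTree s) (suc i) (suc j)
    later = j≢i ∘ sym , proj₂ (PathTree.ordered s (suc l) (suc k)) (s≤s (ℕₚ.≮⇒≥ l≮k))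

  -- The path order, given by `rank`, is itself the common extension; the condition on parents
  -- propagates along the paths of `T`.
  linearExtension⇒compatible : LinearExtension (s ⟨$⟩ʳ_) → Compatible T (pathTree s)
  linearExtension⇒compatible ext = _<_ , isSTO , T⇒< , s⇒<
    where
    _<_ : Rel (Fin (suc n)) 0ℓ
    i < j = rank s i ℕ.< rank s j

    compare : Trichotomous _≡_ _<_
    compare i j with ℕₚ.<-cmp (rank s i) (rank s j)
    ... | tri< lt ≢ ≯ = tri< lt (≢ ∘ cong (rank s)) ≯
    ... | tri≈ ≮ eq ≯ = tri≈ ≮ (rank-injective s eq) ≯
    ... | tri> ≮ ≢ gt = tri> ≮ (≢ ∘ cong (rank s)) gt

    isSTO : IsStrictTotalOrder _≡_ _<_
    isSTO = record
      { isStrictPartialOrder = record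
        { isEquivalence = isEquivalence
        ; irrefl        = λ { refl → ℕₚ.<-irrefl refl }
        ; trans         = ℕₚ.<-trans
        ; <-resp-≈      = resp₂ _<_
        }
      ; compare = compare
      }

    parent-< : ∀ i → parent i < suc i
    parent-< i = go (parent i) refl
      where
      go : ∀ x → parent i ≡ x → x < suc i
      go zero    _  = s≤s z≤n
      go (suc p) eq = s≤s (ext (s ⟨$⟩ˡ i) (s ⟨$⟩ˡ p)
        (trans (cong parent (Perm.inverseʳ s)) (trans eq (cong suc (sym (Perm.inverseʳ s))))))

    ≼⇒≤ : ∀ i j → i ≼ j → rank s i ℕ.≤ rank s j
    ≼⇒≤ i = parent-induction _ base step
      where
      base : i ≼ zero → rank s i ℕ.≤ rank s zero
      base m with subst (i ∈_) ancestors-zero m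
      ... | here refl = ℕₚ.≤-refl
      ... | there ()
      step : ∀ j → (i ≼ parent j → rank s i ℕ.≤ rank s (parent j)) → i ≼ suc j → rank s i ℕ.≤ rank s (suc j)
      step j IH m with ≼-suc⁻ m
      ... | inj₁ refl = ℕₚ.≤-refl
      ... | inj₂ m′   = ℕₚ.≤-trans (IH m′) (ℕₚ.<⇒≤ (parent-< j))

    T⇒< : SpanningTree._≺_ T ⇒ _<_
    T⇒< {i} {j} (i≢j , m) = ℕₚ.≤∧≢⇒< (≼⇒≤ i j m) (i≢j ∘ rank-injective s)

    s⇒< : SpanningTree._≺_ (pathTree s) ⇒ _<_
    s⇒< (i≢j , m) = ℕₚ.≤∧≢⇒< (PathTree.≼-rank s m) (i≢j ∘ rank-injective s)

-- The expansion, its uniqueness, and the star.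

module Expansion {c ℓ₁ ℓ₂} (K : OrderedField c ℓ₁ ℓ₂) where

  open OrderedFieldProperties K
  open PathProducts K
  open Kronecker K
  open LinearIndependence K
  open SpanningTree using (distortion)

  module _ {n : ℕ} (T : SpanningTree n) where

    open Rooted T using (parent)
    open Forest parent using (minimal?)
    open ForestSum K parent using (extends)

    extends-yes : ∀ {m} (u : Fin m → Fin n) → (∀ k l → parent (u k) ≡ suc (u l) → l Fin.< k) → extends u ≈ 1#
    extends-yes {zero}  u ext = ≈-refl
    extends-yes {suc m} u ext = ≈-trans
      (*-cong (𝟙-yes (minimal? u (u zero)) (λ (l , eq) → contradiction (ext zero l eq) λ ()))
        (extends-yes (u ∘ suc) (λ k l eq → ℕₚ.≤-pred (ext (suc k) (suc l) eq)))) (*-identityˡ 1#)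

    extends-no : ∀ {m} (u : Fin m → Fin n) → ¬ (∀ k l → parent (u k) ≡ suc (u l) → l Fin.< k) → extends u ≈ 0#
    extends-no {zero}  u ¬ext = contradiction (λ ()) ¬ext
    extends-no {suc m} u ¬ext = by-cases (minimal? u (u zero))
      where
      by-cases : Dec (Forest.Minimal parent u (u zero)) → extends u ≈ 0#
      by-cases (no ¬min) = ≈-trans (*-congʳ (𝟙-no (minimal? u (u zero)) ¬min)) (zeroˡ _)
      by-cases (yes min) = ≈-trans (*-congˡ (extends-no (u ∘ suc) λ ext → ¬ext λ
        { zero    l       eq → contradiction (l , eq) min
        ; (suc k) zero    eq → s≤s z≤n
        ; (suc k) (suc l) eq → s≤s (ext k l eq) })) (zeroʳ _)

    C-extends : ∀ s → C T (pathTree s) ≈ extends (s ⟨$⟩ʳ_)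
    C-extends s = by-cases (compatible? T (pathTree s))
      where
      -- The decision is kept abstract, so the search inside `compatible?` is never unfolded.
      by-cases : (d : Dec (Compatible T (pathTree s))) → 𝟙 (does d) ≈ extends (s ⟨$⟩ʳ_)
      by-cases (yes comp) = ≈-sym (extends-yes (s ⟨$⟩ʳ_) (Compatibility.compatible⇒linearExtension T s comp))
      by-cases (no ¬comp) = ≈-sym (extends-no (s ⟨$⟩ʳ_) (¬comp ∘ Compatibility.linearExtension⇒compatible T s))

  module _ {n : ℕ} where

    word : Permutation′ n → Vector Carrier n → Carrier
    word s v = pathProduct 0 (label ∘ (s ⟨$⟩ʳ_)) (v ∘ (s ⟨$⟩ʳ_))

    previous : ∀ {m} → ℕ → (Fin m → ℕ) → Fin m → ℕ
    previous p lab zero    = p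
    previous p lab (suc k) = lab (inject₁ k)

    previous-suc : ∀ {m} p (lab : Fin (suc m) → ℕ) k → previous (lab zero) (lab ∘ suc) k ≡ previous p lab (suc k)
    previous-suc p lab zero    = refl
    previous-suc p lab (suc k) = refl

    -- The recursion unrolled into a product over positions, to match a tree product reindexed by
    -- `s`.
    pathProduct-∏ : ∀ {m} p (lab : Fin m → ℕ) (x : Fin m → Carrier) →
      pathProduct p lab x ≈ ∏ (λ k → factor (previous p lab k) (lab k) (sum (λ l → 𝟙 (does (k Finₚ.≤? l)) · x l)))
    pathProduct-∏ {zero}  p lab x = ≈-refl
    pathProduct-∏ {suc m} p lab x = *-cong
      (factor-cong p (lab zero) (sum-cong-≋ (λ l → ≈-sym (*-identityˡ (x l)))))
      (≈-trans (pathProduct-∏ (lab zero) (lab ∘ suc) (x ∘ suc)) (∏-cong tail))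
      where
      tail : ∀ k → factor (previous (lab zero) (lab ∘ suc) k) (lab (suc k)) (sum (λ l → 𝟙 (does (k Finₚ.≤? l)) · x (suc l))) ≈
        factor (lab (inject₁ k)) (lab (suc k)) (𝟙 (does (suc k Finₚ.≤? zero {m})) · x zero + sum (λ l → 𝟙 (does (suc k Finₚ.≤? suc l)) · x (suc l)))
      tail k = ≈-trans (reflexive (cong (λ q → factor q (lab (suc k)) (sum (λ l → 𝟙 (does (k Finₚ.≤? l)) · x (suc l)))) (previous-suc p lab k)))
        (factor-cong (lab (inject₁ k)) (lab (suc k)) (≈-sym (≈-trans (+-cong (zeroˡ (x zero))
          (sum-cong-≋ (λ l → *-congʳ {x (suc l)} (reflexive (cong 𝟙 (does-⇔ (mk⇔ ℕₚ.≤-pred s≤s) (suc k Finₚ.≤? suc l) (k Finₚ.≤? l))))))) (+-identityˡ _))))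

    -- In a path the subtree at position k consists of the positions from k on, so the flow there is
    -- a tail sum.
    treeProduct-pathTree : ∀ s v → TreeIndicator.treeProduct K (pathTree s) v ≈ word s v
    treeProduct-pathTree s v = begin
      ∏ (parentFactor v)
        ≈⟨ ∏-permute (parentFactor v) s ⟩
      ∏ (λ k → parentFactor v (s ⟨$⟩ʳ k))
        ≈⟨ ∏-cong same ⟩
      ∏ (λ k → factor (previous 0 lab k) (lab k) (sum (λ l → 𝟙 (does (k Finₚ.≤? l)) · v (s ⟨$⟩ʳ l))))
        ≈⟨ pathProduct-∏ 0 lab (v ∘ (s ⟨$⟩ʳ_)) ⟨
      word s v ∎
      where
      open ≈-Reasoning
      open TreeIndicator K (pathTree s)
      open PathTree s
      open Rooted (pathTree s) using (_≼?_)
      lab : Fin n → ℕ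
      lab = label ∘ (s ⟨$⟩ʳ_)
      toℕ-at : ∀ k → toℕ (at (inject₁ k)) ≡ previous 0 lab k
      toℕ-at zero    = refl
      toℕ-at (suc k) = refl
      same : ∀ k → parentFactor v (s ⟨$⟩ʳ k) ≈ factor (previous 0 lab k) (lab k) (sum (λ l → 𝟙 (does (k Finₚ.≤? l)) · v (s ⟨$⟩ʳ l)))
      same k = ≈-trans
        (reflexive (cong (λ p → factor p (lab k) (flow v (s ⟨$⟩ʳ k))) (trans (cong toℕ (parent-at k)) (toℕ-at k))))
        (factor-cong (previous 0 lab k) (lab k) (≈-trans (sum-permute (λ y → below (s ⟨$⟩ʳ k) y · v y) s)
          (sum-cong-≋ (λ l → *-congʳ {v (s ⟨$⟩ʳ l)} (reflexive (cong 𝟙 (does-⇔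
            (mk⇔ (ℕₚ.≤-pred ∘ proj₁ (ordered (suc l) (suc k))) (proj₂ (ordered (suc l) (suc k)) ∘ s≤s))
            (at (suc k) ≼? at (suc l)) (k Finₚ.≤? l))))))))

    sign-distortion-pathTree : ∀ (s : Permutation′ n) → sign (distortion (pathTree s)) ≈
      ∏ (λ k → negateIf (does (PathTree.at s (suc k) <? PathTree.at s (inject₁ k))))
    sign-distortion-pathTree s = ≈-trans (TreeIndicator.sign-distortion K (pathTree s))
      (≈-trans (∏-permute (TreeIndicator.orientation K (pathTree s)) s)
        (∏-cong (λ k → reflexive (cong (λ p → negateIf (does (PathTree.at s (suc k) <? p))) (PathTree.parent-at s k)))))

    -- Pointwise equal permutations need not give equal `pathTree` records; the product formula sees
    -- only the values of `s`.
    sign-distortion-cong : ∀ {s s′ : Permutation′ n} → s Perm.≈ s′ →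
      sign (distortion (pathTree s)) ≈ sign (distortion (pathTree s′))
    sign-distortion-cong {s} {s′} eq = ≈-trans (sign-distortion-pathTree s) (≈-trans
      (∏-cong (λ k → reflexive (cong₂ (λ i j → negateIf (does (i <? j)))
        (Perm.lift₀-cong s s′ eq (suc k)) (Perm.lift₀-cong s s′ eq (inject₁ k)))))
      (≈-sym (sign-distortion-pathTree s′)))

    hyperplanes : SpanningTree n → List (Vector Carrier n)
    hyperplanes T = tabulate (TreeIndicator.below K T)

    pathHyperplanes : List (Vector Carrier n)
    pathHyperplanes = concatMap (hyperplanes ∘ pathTree) (permutations n)

    hyperplanes-nonzero : ∀ T → All Nonzero (hyperplanes T)
    hyperplanes-nonzero T = Allₚ.tabulate⁺ λ j zeros → 1≉0
      (≈-trans (≈-sym (𝟙-yes (suc j ≼? suc j) (self∈ancestors (suc j)))) (zeros j))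
      where open Rooted T

    pathHyperplanes-nonzero : All Nonzero pathHyperplanes
    pathHyperplanes-nonzero = Allₚ.concat⁺ (Allₚ.map⁺ (All.universal (hyperplanes-nonzero ∘ pathTree) (permutations n)))

    Off : Vector Carrier n → Vector Carrier n → Set ℓ₁
    Off v a = ¬ sum (λ k → a k · v k) ≈ 0#

    ∑-cong-All : ∀ {a p} {A : Set a} {P : A → Set p} {f g : A → Carrier} → (∀ {x} → P x → f x ≈ g x) →
      ∀ {xs} → All P xs → ∑ xs f ≈ ∑ xs g
    ∑-cong-All eq []         = ≈-refl
    ∑-cong-All eq (px ∷ pxs) = +-cong (eq px) (∑-cong-All eq pxs)

    off-pathHyperplanes : ∀ v → All (Off v) pathHyperplanes → All (λ s → All (Off v) (hyperplanes (pathTree s))) (permutations n)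
    off-pathHyperplanes v = Allₚ.map⁻ ∘ Allₚ.concat⁻

    module _ (χ : SpanningTree n → Vector Carrier n → Carrier) (χ-ind : ∀ T → IsIndicator (pos T) (χ T)) where

      coefficient : SpanningTree n → Permutation′ n → Carrier
      coefficient T s = sign (distortion T ℕ.+ distortion (pathTree s)) · C T (pathTree s)

      χ-treeProduct : ∀ T v → All (Off v) (hyperplanes T) → χ T v ≈ sign (distortion T) · TreeIndicator.treeProduct K T v
      χ-treeProduct T v off = TreeIndicator.indicator-formula K T (χ-ind T) v (Allₚ.tabulate⁻ off)

      χ-word : ∀ s v → All (Off v) (hyperplanes (pathTree s)) → sign (distortion (pathTree s)) · χ (pathTree s) v ≈ word s v
      χ-word s v off = ≈-trans (*-congˡ (χ-treeProduct (pathTree s) v off))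
        (≈-trans (sign-cancel (distortion (pathTree s)) _) (treeProduct-pathTree s v))

      -- Off the hyperplanes of `T` and of all path trees, every indicator involved is a signed
      -- product.
      expansion : ∀ T → IsExpansion χ T (coefficient T)
      expansion T = hyperplanes T ++ pathHyperplanes , Allₚ.++⁺ (hyperplanes-nonzero T) pathHyperplanes-nonzero , λ v off → begin
        χ T v
          ≈⟨ χ-treeProduct T v (Allₚ.++⁻ˡ (hyperplanes T) off) ⟩
        sign (distortion T) · TreeIndicator.treeProduct K T v
          ≈⟨ *-congˡ (TreeIndicator.treeProduct-expansion K T v) ⟩
        sign (distortion T) · ∑ (permutations n) (λ s → extends (s ⟨$⟩ʳ_) · word s v)
          ≈⟨ ∑-distribˡ (sign (distortion T)) _ (permutations n) ⟩
        ∑ (permutations n) (λ s → sign (distortion T) · (extends (s ⟨$⟩ʳ_) · word s v))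
          ≈⟨ ∑-cong-All (λ {s} → term v s) (off-pathHyperplanes v (Allₚ.++⁻ʳ (hyperplanes T) off)) ⟩
        ∑ (permutations n) (λ s → coefficient T s · χ (pathTree s) v) ∎
        where
        open ≈-Reasoning
        open ForestSum K (Rooted.parent T) using (extends)
        term : ∀ v s → All (Off v) (hyperplanes (pathTree s)) →
          sign (distortion T) · (extends (s ⟨$⟩ʳ_) · word s v) ≈ coefficient T s · χ (pathTree s) v
        term v s off = begin
          sign (distortion T) · (extends (s ⟨$⟩ʳ_) · word s v)
            ≈⟨ *-congˡ (*-cong (≈-sym (C-extends T s)) (≈-sym (χ-word s v off))) ⟩
          sign (distortion T) · (C T (pathTree s) · (sign (distortion (pathTree s)) · χ (pathTree s) v))
            ≈⟨ solve 4 (λ a b c d → a :* (b :* (c :* d)) := ((a :* c) :* b) :* d) ≈-refl _ _ _ _ ⟩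
          ((sign (distortion T) · sign (distortion (pathTree s))) · C T (pathTree s)) · χ (pathTree s) v
            ≈⟨ *-congʳ (*-congʳ (^-homo-* (- 1#) (distortion T) (distortion (pathTree s)))) ⟨
          coefficient T s · χ (pathTree s) v ∎

      coefficient-split : ∀ T s → coefficient T s ≈
        (sign (distortion T) · sign (distortion (pathTree s))) · ForestSum.extends K (Rooted.parent T) (s ⟨$⟩ʳ_)
      coefficient-split T s = *-cong (^-homo-* (- 1#) (distortion T) (distortion (pathTree s))) (C-extends T s)

      coefficient-cong : ∀ T → coefficient T Preserves Perm._≈_ ⟶ _≈_
      coefficient-cong T {s} {s′} eq = ≈-trans (coefficient-split T s) (≈-trans
        (*-cong (*-congˡ (sign-distortion-cong eq)) (ForestSum.extends-cong K (Rooted.parent T) eq))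
        (≈-sym (coefficient-split T s′)))

      -- The difference of two expansions, with the signs of the path trees moved into the
      -- coefficients, is a relation between the functions `word s` off finitely many hyperplanes.
      expansion-unique : ∀ T (a b : Permutation′ n → Carrier) → a Preserves Perm._≈_ ⟶ _≈_ → b Preserves Perm._≈_ ⟶ _≈_ →
        IsExpansion χ T a → IsExpansion χ T b → ∀ s → a s ≈ b s
      expansion-unique T a b a-cong b-cong (as , as≢0 , a-exp) (bs , bs≢0 , b-exp) s =
        x-y≈0⇒x≈y (a s) (b s) (begin
          a s - b s                   ≈⟨ sign-cancel (distortion (pathTree s)) _ ⟨
          sign (distortion (pathTree s)) · (sign (distortion (pathTree s)) · (a s - b s))
                                      ≈⟨ *-congˡ (≈-trans (*-comm _ _) (vanishes s)) ⟩
          sign (distortion (pathTree s)) · 0#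
                                      ≈⟨ zeroʳ _ ⟩
          0#                          ∎)
        where
        open ≈-Reasoning
        δs : Permutation′ n → Carrier
        δs s = (a s - b s) · sign (distortion (pathTree s))

        nonzero : All Nonzero (as ++ (bs ++ pathHyperplanes))
        nonzero = Allₚ.++⁺ as≢0 (Allₚ.++⁺ bs≢0 pathHyperplanes-nonzero)

        relation : ∀ v → All (Avoids v) (as ++ (bs ++ pathHyperplanes)) → ∑ (permutations n) (λ s → δs s · word s v) ≈ 0#
        relation v avoids = begin
          ∑ (permutations n) (λ s → δs s · word s v)
            ≈⟨ ∑-cong-All (λ {s} off → term s off) (off-pathHyperplanes v (Allₚ.++⁻ʳ bs off′)) ⟩
          ∑ (permutations n) (λ s → a s · χ (pathTree s) v + - 1# · (b s · χ (pathTree s) v))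
            ≈⟨ ∑-+ _ _ (permutations n) ⟩
          ∑ (permutations n) (λ s → a s · χ (pathTree s) v) + ∑ (permutations n) (λ s → - 1# · (b s · χ (pathTree s) v))
            ≈⟨ +-cong (a-exp v (Allₚ.++⁻ˡ as off)) (≈-trans (*-congˡ (b-exp v (Allₚ.++⁻ˡ bs off′))) (∑-distribˡ (- 1#) _ (permutations n))) ⟨
          χ T v + - 1# · χ T v
            ≈⟨ ≈-trans (+-congˡ (-1*x≈-x (χ T v))) (-‿inverseʳ (χ T v)) ⟩
          0# ∎
          where
          -- All normals in the list are nonzero, so the conditional avoidance takes effect.
          off : All (Off v) (as ++ (bs ++ pathHyperplanes))
          off = All.zipWith (λ (avoid , a≢0) → avoid a≢0) (avoids , nonzero)
          off′ = Allₚ.++⁻ʳ as off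
          term : ∀ s → All (Off v) (hyperplanes (pathTree s)) →
            δs s · word s v ≈ a s · χ (pathTree s) v + - 1# · (b s · χ (pathTree s) v)
          term s off = begin
            δs s · word s v
              ≈⟨ ≈-trans (*-assoc _ _ _) (*-congˡ (≈-trans (*-congˡ (≈-sym (χ-word s v off))) (sign-cancel (distortion (pathTree s)) _))) ⟩
            (a s - b s) · χ (pathTree s) v
              ≈⟨ ≈-trans (*-congʳ (+-congˡ (≈-sym (-1*x≈-x (b s))))) (solve 4 (λ a b m x → (a :+ m :* b) :* x := a :* x :+ m :* (b :* x)) ≈-refl _ _ _ _) ⟩
            a s · χ (pathTree s) v + - 1# · (b s · χ (pathTree s) v) ∎

        vanishes : ∀ s → δs s ≈ 0#
        vanishes = pathProduct-independent 0 label (Finₚ.toℕ-injective ∘ ℕₚ.suc-injective) δs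
          (λ eq → *-cong (+-cong (a-cong eq) (-‿cong (b-cong eq))) (sign-distortion-cong eq))
          (as ++ (bs ++ pathHyperplanes)) relation

      IsExpansion-cong : ∀ T {a b : Permutation′ n → Carrier} → (∀ s → a s ≈ b s) → IsExpansion χ T a → IsExpansion χ T b
      IsExpansion-cong T eq (as , as≢0 , exp) = as , as≢0 , λ v off →
        ≈-trans (exp v off) (∑-cong (λ s → *-congʳ (eq s)) (permutations n))

      starTree-parent : ∀ i → Rooted.parent (starTree n) i ≡ zero
      starTree-parent i = root (Rooted.parent-adj (starTree n) i)
        where
        root : ∀ {x} → SymClosure FromRoot x (suc i) → x ≡ zero
        root (fwd (0— _)) = refl
        root (bwd ())

      -- Every parent is 0: being the smallest label it causes no distortion, and not being a letter
      -- it puts no condition on `s`.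
      coefficient-starTree : ∀ s → coefficient (starTree n) s ≈ sign (distortion (pathTree s))
      coefficient-starTree s = ≈-trans (coefficient-split (starTree n) s) (≈-trans
        (*-cong (≈-trans (*-congʳ undistorted) (*-identityˡ _))
          (extends-yes (starTree n) (s ⟨$⟩ʳ_) (λ k l eq → contradiction (trans (sym eq) (starTree-parent (s ⟨$⟩ʳ k))) λ ())))
        (*-identityʳ _))
        where
        undistorted : sign (distortion (starTree n)) ≈ 1#
        undistorted = ≈-trans (TreeIndicator.sign-distortion K (starTree n))
          (∏-one _ (λ i → TreeIndicator.orientation-no K (starTree n) (λ lt → contradiction (subst (suc i Fin.<_) (starTree-parent i) lt) λ ())))

theorem1p4 : ∀ {c ℓ₁ ℓ₂} (K : OrderedField c ℓ₁ ℓ₂) (n : ℕ) →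
    let open OrderedField K
        open Cones K
        open SpanningTree using (distortion)
        coefficient : SpanningTree n → Permutation′ n → Carrier
        coefficient T s = sign (distortion T +ℕ distortion (pathTree s)) · C T (pathTree s)
    in
    (χ : SpanningTree n → Vector Carrier n → Carrier) →
    (∀ T → IsIndicator (pos T) (χ T)) →
    (∀ T →
      IsExpansion χ T (coefficient T) ×
      (∀ (a : Permutation′ n → Carrier) → a Preserves Perm._≈_ ⟶ _≈_ →
        IsExpansion χ T a → ∀ s → a s ≈ coefficient T s)) ×
    IsExpansion χ (starTree n) (λ s → sign (distortion (pathTree s)))
theorem1p4 K n χ ind =
  (λ T → expansion χ ind T , λ a a-cong a-exp →
    expansion-unique χ ind T a (coefficient χ ind T) a-cong (coefficient-cong χ ind T) a-exp (expansion χ ind T)) ,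
  IsExpansion-cong χ ind (starTree n) (coefficient-starTree χ ind) (expansion χ ind (starTree n))
  where open Expansion K
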